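{- Let $X\subset\mathbb{P}^5_{\mathbb{Q}}$ be the complete intersection of three quadrics given in affine coordinates $(x,y,u,v,w)$ by $$x+y=u^2,\qquad xy+x+y=v^2,\qquad xy-x-y=w^2.$$ Then $X$ is a rational surface over $\mathbb{Q}$. More precisely, the formulas $$x=\lambda^2+a^2+\frac{1}{4a^2},\quad y=\left(a^2+\frac{1}{4a^2}\right)\frac{x}{\lambda^2},\quad u=\frac{x}{\lambda},\quad v=\left(a+\frac{1}{2a}\right)\frac{x}{\lambda},\quad w=\left(a-\frac{1}{2a}\right)\frac{x}{\lambda}$$ in the parameters $(a,\lambda)$ define a birational map $\mathbb{P}^2\dashrightarrow X$ over $\mathbb{Q}$.
   Context: In homogeneous coordinates $(x:y:u:v:w:z)$ on $\mathbb{P}^5$, the surface $X$ is given by $(x+y)z=u^2$, $xy+(x+y)z=v^2$, $xy-(x+y)z=w^2$. Here $(a,\lambda)$ are affine coordinates on $\mathbb{P}^2$. A rational surface over $\mathbb{Q}$ means a surface birationally equivalent to $\mathbb{P}^2$ over $\mathbb{Q}$. -}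

module Defs where

open import Data.Bool.Base using (if_then_else_)
open import Data.Fin.Base using (Fin)
open import Data.Fin.Patterns using (0F; 1F; 2F; 3F; 4F; 5F)
open import Data.Integer.Base using (+_)
open import Data.List.Base as List using (List; []; _∷_; _++_)
open import Data.List.Relation.Unary.All using (All; []; _∷_)
open import Data.Nat.Base as ℕ using (ℕ; zero; suc)
import Data.Nat.Properties as ℕ
open import Data.Product.Base using (_×_; _,_; ∃)
open import Data.Rational.Base as ℚ using (ℚ; 0ℚ; 1ℚ)
import Data.Rational.Properties as ℚ
open import Data.Sum.Base using (_⊎_)
open import Data.Vec.Base as Vec using (Vec; []; _∷_; _∷ʳ_; _[_]≔_; lookup)
import Data.Vec.Properties as Vec
open import Relation.Binary.PropositionalEquality using (_≡_; _≢_; refl; subst)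
open import Relation.Nullary using (¬_; Dec; yes; no; does; contradiction)

------------------------------------------------------------------------
-- Polynomials over ℚ

-- A polynomial in n variables is a formal sum of terms c · x₀^e₀ ⋯ xₙ₋₁^eₙ₋₁.
-- A monomial may be listed several times, or with coefficient 0; two such
-- sums are the same polynomial when all their coefficients agree (_≈_).
Poly : ℕ → Set
Poly n = List (ℚ × Vec ℕ n)

_≟ᵐ_ : ∀ {n} (e m : Vec ℕ n) → Dec (e ≡ m)
_≟ᵐ_ = Vec.≡-dec ℕ._≟_

coeff : ∀ {n} → Poly n → Vec ℕ n → ℚ
coeff []            m = 0ℚ
coeff ((c , e) ∷ f) m = (if does (e ≟ᵐ m) then c else 0ℚ) ℚ.+ coeff f m

infix  4 _≈_
infixl 6 _+_ _-_
infixl 7 _*_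
infixr 8 _^_

record _≈_ {n} (f g : Poly n) : Set where
  constructor mk≈
  field
    coeff-≡ : ∀ m → coeff f m ≡ coeff g m

con : ∀ {n} → ℚ → Poly n
con {n} c = (c , Vec.replicate n 0) ∷ []

var : ∀ {n} → Fin n → Poly n
var {n} i = (1ℚ , Vec.replicate n 0 [ i ]≔ 1) ∷ []

_+_ : ∀ {n} → Poly n → Poly n → Poly n
_+_ = _++_

-_ : ∀ {n} → Poly n → Poly n
-_ = List.map λ (c , e) → ℚ.- c , e

_-_ : ∀ {n} → Poly n → Poly n → Poly n
f - g = f + (- g)

_*_ : ∀ {n} → Poly n → Poly n → Poly n
_*_ = List.cartesianProductWith
  λ (c , e) (c′ , e′) → c ℚ.* c′ , Vec.zipWith ℕ._+_ e e′

_^_ : ∀ {n} → Poly n → ℕ → Poly n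
f ^ zero  = con 1ℚ
f ^ suc k = f * f ^ k

∑ ∏ : ∀ {n k} → Vec (Poly n) k → Poly n
∑ = Vec.foldr′ _+_ []
∏ = Vec.foldr′ _*_ (con 1ℚ)

vars : ∀ {n} → Vec (Poly n) n
vars = Vec.tabulate var

-- f ⟪ F ⟫ is f (F₀ , … , Fₙ₋₁).
_⟪_⟫ : ∀ {n m} → Poly n → Vec (Poly m) n → Poly m
f ⟪ F ⟫ = List.foldr (λ (c , e) g → con c * ∏ (Vec.zipWith _^_ F e) + g) [] f

Homogeneous : ∀ {n} → ℕ → Poly n → Set
Homogeneous d f = ∀ m → coeff f m ≢ 0ℚ → Vec.sum m ≡ d

terms⇒Homogeneous : ∀ {n d} (f : Poly n) →
  All (λ (c , e) → Vec.sum e ≡ d) f → Homogeneous d f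
terms⇒Homogeneous []            []       m c≢0 = contradiction refl c≢0
terms⇒Homogeneous ((c , e) ∷ f) (p ∷ ps) m c≢0 with e ≟ᵐ m
... | yes refl = p
... | no  _    = terms⇒Homogeneous f ps m
  (subst (_≢ 0ℚ) (ℚ.+-identityˡ (coeff f m)) c≢0)

-- Membership in the ideal generated by gs.
_∈⟨_⟩ : ∀ {n k} → Poly n → Vec (Poly n) k → Set
_∈⟨_⟩ {n} {k} f gs = ∃ λ (hs : Vec (Poly n) k) → f ≈ ∑ (Vec.zipWith _*_ hs gs)

------------------------------------------------------------------------
-- Closed subschemes of projective space over ℚ

record ProjScheme (n : ℕ) : Set where
  field
    {size}      : ℕ
    eqs         : Vec (Poly (suc n)) size
    homogeneous : ∀ i → ∃ λ d → Homogeneous d (lookup eqs i)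

open ProjScheme using (eqs)

ℙ : ∀ n → ProjScheme n
ℙ n = record { eqs = [] ; homogeneous = λ () }

-- f lies in the saturation of the ideal I of X: on each standard chart
-- xᵢ ≠ 0, some xᵢ^N · f lies in I.  For homogeneous f this says that f
-- restricts to the zero section on the scheme X.
VanishesOn : ∀ {n} → ProjScheme n → Poly (suc n) → Set
VanishesOn X f = ∀ i → ∃ λ N → (var i ^ N * f) ∈⟨ eqs X ⟩

-- X = Proj (S / I) is an integral scheme iff the saturation of I is a
-- prime ideal of S.
record IsIntegral {n} (X : ProjScheme n) : Set where
  field
    nonempty : ¬ VanishesOn X (con 1ℚ)
    prime    : ∀ f g → VanishesOn X (f * g) → VanishesOn X f ⊎ VanishesOn X g

------------------------------------------------------------------------
-- Rational maps.  The notions below are the usual ones when the source of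
-- each map is integral.

NonzeroOn : ∀ {n k} → ProjScheme n → Vec (Poly (suc n)) k → Set
NonzeroOn X F = ∃ λ i → ¬ VanishesOn X (lookup F i)

-- Equality on X of the points (F₀ : … : Fₘ) and (G₀ : … : Gₘ).
Proportional : ∀ {n m} → ProjScheme n → (F G : Vec (Poly (suc n)) (suc m)) → Set
Proportional X F G = ∀ i j →
  VanishesOn X (lookup F i * lookup G j - lookup F j * lookup G i)

-- A representative (F₀ : … : Fₘ) of a rational map X ⇢ Y.
record RationalMap {n m} (X : ProjScheme n) (Y : ProjScheme m) : Set where
  field
    degree      : ℕ
    components  : Vec (Poly (suc n)) (suc m)
    homogeneous : ∀ i → Homogeneous degree (lookup components i)
    nonzero     : NonzeroOn X components
    image       : ∀ i → VanishesOn X (lookup (eqs Y) i ⟪ components ⟫)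

open RationalMap using (components)

-- ψ ∘ φ is defined (the generic point of X is not mapped into the base
-- locus of ψ) and equals the identity as a rational map.
ComposeToId : ∀ {n m} {X : ProjScheme n} {Y : ProjScheme m} →
  RationalMap Y X → RationalMap X Y → Set
ComposeToId {X = X} ψ φ = NonzeroOn X ψ∘φ × Proportional X ψ∘φ vars
  where
  ψ∘φ = Vec.map (_⟪ components φ ⟫) (components ψ)

IsBirational : ∀ {n m} {X : ProjScheme n} {Y : ProjScheme m} →
  RationalMap X Y → Set
IsBirational {X = X} {Y} φ = ∃ λ (ψ : RationalMap Y X) →
  ComposeToId ψ φ × ComposeToId φ ψ

-- That X has dimension 2 is implied by birationality to ℙ².
IsRationalSurface : ∀ {n} → ProjScheme n → Set
IsRationalSurface X =
  IsIntegral X × ∃ λ (φ : RationalMap (ℙ 2) X) → IsBirational φ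

------------------------------------------------------------------------
-- Rational functions and maps given in affine coordinates

-- Formal fractions; a fraction represents a rational function only when
-- its denominator is nonzero, which _GivenBy_ requires.
record Fraction (n : ℕ) : Set where
  constructor _÷_
  field
    num den : Poly n

open Fraction

module FractionOps {n : ℕ} where
  infixl 6 _⊕_ _⊖_
  infixl 7 _⊗_ _⊘_
  infixl 8 _²

  const : ℚ → Fraction n
  const c = con c ÷ con 1ℚ

  param : Fin n → Fraction n
  param i = var i ÷ con 1ℚ

  _⊕_ _⊖_ _⊗_ _⊘_ : Fraction n → Fraction n → Fraction n
  (p ÷ q) ⊕ (r ÷ s) = (p * s + r * q) ÷ (q * s)
  (p ÷ q) ⊖ (r ÷ s) = (p * s - r * q) ÷ (q * s)
  (p ÷ q) ⊗ (r ÷ s) = (p * r) ÷ (q * s)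
  (p ÷ q) ⊘ (r ÷ s) = (p * s) ÷ (q * r)

  _² : Fraction n → Fraction n
  r ² = r ⊗ r

-- The last homogeneous coordinate is set to 1.
dehomogenise : ∀ {n} → Poly (suc n) → Poly n
dehomogenise f = f ⟪ vars ∷ʳ con 1ℚ ⟫

-- In the affine charts where the last coordinate is 1, φ is the map
-- (t₁ , … , tₙ) ↦ (r₁ , … , rₘ).
record _GivenBy_ {n m} {Y : ProjScheme m} (φ : RationalMap (ℙ n) Y)
                 (r : Vec (Fraction n) m) : Set where
  F : Vec (Poly n) (suc m)
  F = Vec.map dehomogenise (components φ)

  field
    meetsChart : ¬ (Vec.last F ≈ con 0ℚ)
    den≉0      : ∀ i → ¬ (den (lookup r i) ≈ con 0ℚ)
    agrees     : ∀ i → lookup (Vec.init F) i * den (lookup r i)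
                     ≈ num (lookup r i) * Vec.last F

------------------------------------------------------------------------
-- The surface X and its parametrisation

-- Homogeneous coordinates (x : y : u : v : w : z) on ℙ⁵.
X : ProjScheme 5
X = record
  { eqs         = quadrics
  ; homogeneous = λ i → 2 , quadrics-homogeneous i
  }
  where
  x y u v w z : Poly 6
  x = var 0F
  y = var 1F
  u = var 2F
  v = var 3F
  w = var 4F
  z = var 5F

  quadrics : Vec (Poly 6) 3
  quadrics = ((x + y) * z - u ^ 2)
           ∷ (x * y + (x + y) * z - v ^ 2)
           ∷ (x * y - (x + y) * z - w ^ 2)
           ∷ []

  quadrics-homogeneous : ∀ i → Homogeneous 2 (lookup quadrics i)
  quadrics-homogeneous 0F = terms⇒Homogeneous _ (refl ∷ refl ∷ refl ∷ [])
  quadrics-homogeneous 1F = terms⇒Homogeneous _ (refl ∷ refl ∷ refl ∷ refl ∷ [])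
  quadrics-homogeneous 2F = terms⇒Homogeneous _ (refl ∷ refl ∷ refl ∷ refl ∷ [])

-- The affine coordinates (x , y , u , v , w) as functions of (a , λ);
-- l stands for λ.
parametrisation : Vec (Fraction 2) 5
parametrisation = x ∷ y ∷ u ∷ v ∷ w ∷ []
  where
  open FractionOps

  one two four a l x y u v w : Fraction 2
  one  = const 1ℚ
  two  = const (+ 2 ℚ./ 1)
  four = const (+ 4 ℚ./ 1)
  a    = param 0F
  l    = param 1F
  x = l ² ⊕ a ² ⊕ one ⊘ (four ⊗ a ²)
  y = (a ² ⊕ one ⊘ (four ⊗ a ²)) ⊗ (x ⊘ l ²)
  u = x ⊘ l
  v = (a ⊕ one ⊘ (two ⊗ a)) ⊗ (x ⊘ l)
  w = (a ⊖ one ⊘ (two ⊗ a)) ⊗ (x ⊘ l)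

{-# OPTIONS --safe #-}
module Submission where

-- Let S = ℚ[x,y,u,v,w,z] and let I be the ideal of the three quadrics.  After
-- clearing denominators the formulas become six forms φ of degree 8 in the
-- coordinates (a : l : c) of ℙ², with l for λ and c for the homogenising
-- coordinate.  On X one recovers a = (v + w) / (2u) and l = x / u, so the
-- inverse map should be ψ = (v + w : 2x : 2u).  Indeed ψ ∘ φ multiplies (a, l, c)
-- by a nonzero polynomial, and modulo I the composite φ ∘ ψ multiplies
-- (x, y, u, v, w, z) by a form M of degree 7 (roundtrip).
--
-- Everything else follows from the fact that I is the kernel of the
-- homomorphism θ : S → ℚ[a,l,c] given by substitution of φ.  Since ℚ[a,l,c] is
-- an integral domain (*-≈0), I is then prime and equal to its saturation, and
-- f vanishes on X exactly when θ f = 0.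
--
-- That θ kills I is a computation (ideal⇒kernel).  Conversely let θ f = 0.  As
-- the components of φ are forms of one positive degree, θ kills the homogeneous
-- components of f as well (component-⟪⟫), so f may be taken to be a form, of
-- degree d say.  Substituting ψ into θ f gives M^d f modulo I (ev-scale), so M^d f
-- lies in I, and it remains to see that M is not a zero divisor in S / I
-- (M-Regular).
--
-- Now S / I embeds in the ring obtained from ℚ[x,y,z] by adjoining square roots
-- u, v, w of (x + y) z, xy + (x + y) z and xy - (x + y) z one after the other
-- (ν-injective).  That ring is free over ℚ[x,y,z], so the nonzero elements of
-- ℚ[x,y,z] are not zero divisors in S / I (Regular-S/I).  Up to a constant M is
-- b⁴ x² (x + y), where b = v + w, and b divides the nonzero element 2 (x + y) z
-- of ℚ[x,y,z], since (v + w) (v - w) = v² - w² = 2 (x + y) z in S / I.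

open import Algebra.Bundles using (AbelianGroup; CommutativeRing)
import Algebra.Properties.AbelianGroup
import Algebra.Properties.CommutativeSemigroup
import Algebra.Properties.CommutativeSemiring.Exp
import Algebra.Solver.Ring
open import Algebra.Solver.Ring.AlmostCommutativeRing
  using (AlmostCommutativeRing; fromCommutativeRing; _-Raw-AlmostCommutative⟶_)
open import Data.Bool.Base using (Bool; true; false; if_then_else_)
open import Data.Fin.Base using (Fin; zero; suc)
open import Data.Fin.Patterns using (0F; 1F; 2F; 3F; 4F; 5F)
import Data.Integer.Base as ℤ
open import Data.List.Base as List using (List; []; _∷_; length)
import Data.List.Properties as List
open import Data.List.Relation.Unary.All as All using (All; []; _∷_)
import Data.List.Relation.Unary.All.Properties as All
open import Data.List.Relation.Unary.Any using (Any; here; there)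
import Data.List.Relation.Unary.Any.Properties as Any
open import Data.Maybe.Base as Maybe using (Maybe)
open import Data.Nat.Base as ℕ using (ℕ; zero; suc; z≤n; s≤s)
import Data.Nat.Properties as ℕ
open import Data.Product.Base using (_×_; _,_; ∃; proj₁; proj₂)
open import Data.Rational.Base as ℚ using (ℚ; 0ℚ; 1ℚ)
import Data.Rational.Properties as ℚ
open import Data.Sum.Base as Sum using (_⊎_; inj₁; inj₂)
open import Data.Vec.Base as Vec using (Vec; []; _∷_; lookup; _[_]≔_)
import Data.Vec.Properties as Vec
open import Data.Vec.Relation.Binary.Lex.Strict as Lex using (Lex-<; this; next)
open import Data.Vec.Relation.Binary.Pointwise.Inductive using (Pointwise-≡⇒≡)
open import Function.Base using (_∘_)
open import Level using (0ℓ)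
open import Relation.Binary.Definitions using (tri<; tri≈; tri>)
open import Relation.Binary.PropositionalEquality
  using (_≡_; _≢_; refl; sym; trans; cong; cong₂; subst; subst₂; resp₂; isEquivalence;
         module ≡-Reasoning)
import Relation.Binary.Reasoning.Setoid as ≈-Reasoning
open import Relation.Binary.Structures using (IsEquivalence)
open import Relation.Nullary using (¬_; Dec; yes; no; does; contradiction; ¬?)
open import Relation.Nullary.Decidable using (True; False; toWitness; toWitnessFalse; dec⇒maybe)
open import Defs

open ProjScheme using (eqs)

-- The additive group of polynomials

-- The exponent vector of a monomial.
Monomial : ℕ → Set
Monomial n = Vec ℕ n

infixl 6 _+ᵐ_
_+ᵐ_ : ∀ {n} → Monomial n → Monomial n → Monomial n
_+ᵐ_ = Vec.zipWith ℕ._+_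

-- when b c is c if b is true and 0 otherwise, as in the summands of coeff.
when : Bool → ℚ → ℚ
when b c = if b then c else 0ℚ

when-+ : ∀ b c d → when b (c ℚ.+ d) ≡ when b c ℚ.+ when b d
when-+ true  c d = refl
when-+ false c d = refl

when-* : ∀ b c d → when b (c ℚ.* d) ≡ c ℚ.* when b d
when-* true  c d = refl
when-* false c d = sym (ℚ.*-zeroʳ c)

when-0 : ∀ b → when b 0ℚ ≡ 0ℚ
when-0 true  = refl
when-0 false = refl

coeff-+ : ∀ {n} (f g : Poly n) m → coeff (f + g) m ≡ coeff f m ℚ.+ coeff g m
coeff-+ []            g m = sym (ℚ.+-identityˡ _)
coeff-+ ((c , e) ∷ f) g m =
  trans (cong (when (does (e ≟ᵐ m)) c ℚ.+_) (coeff-+ f g m))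
        (sym (ℚ.+-assoc (when (does (e ≟ᵐ m)) c) (coeff f m) (coeff g m)))

coeff-neg : ∀ {n} (f : Poly n) m → coeff (- f) m ≡ ℚ.- coeff f m
coeff-neg []            m = refl
coeff-neg ((c , e) ∷ f) m with does (e ≟ᵐ m)
... | true  = trans (cong (ℚ.- c ℚ.+_) (coeff-neg f m)) (sym (ℚ.neg-distrib-+ c _))
... | false = trans (cong (0ℚ ℚ.+_) (coeff-neg f m)) (sym (ℚ.neg-distrib-+ 0ℚ (coeff f m)))

open _≈_ public

polyGroup : ℕ → AbelianGroup 0ℓ 0ℓ
polyGroup n = record
  { Carrier = Poly n ; _≈_ = _≈_ ; _∙_ = _+_ ; ε = [] ; _⁻¹ = -_
  ; isAbelianGroup = record
    { isGroup = record
      { isMonoid = record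
        { isSemigroup = record
          { isMagma = record
            { isEquivalence = record
              { refl  = mk≈ λ m → refl
              ; sym   = λ p → mk≈ λ m → sym (coeff-≡ p m)
              ; trans = λ p q → mk≈ λ m → trans (coeff-≡ p m) (coeff-≡ q m)
              }
            ; ∙-cong = λ {f} {f′} {g} {g′} p q → mk≈ λ m → trans (coeff-+ f g m)
                (trans (cong₂ ℚ._+_ (coeff-≡ p m) (coeff-≡ q m)) (sym (coeff-+ f′ g′ m)))
            }
          ; assoc = λ f g h → ≡⇒≈ (List.++-assoc f g h)
          }
        ; identity = (λ f → ≡⇒≈ refl) , λ f → ≡⇒≈ (List.++-identityʳ f)
        }
      ; inverse = (λ f → mk≈ λ m → trans (coeff-+ (- f) f m)
                    (trans (cong (ℚ._+ coeff f m) (coeff-neg f m)) (ℚ.+-inverseˡ (coeff f m))))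
                , (λ f → mk≈ λ m → trans (coeff-+ f (- f) m)
                    (trans (cong (coeff f m ℚ.+_) (coeff-neg f m)) (ℚ.+-inverseʳ (coeff f m))))
      ; ⁻¹-cong = λ {f} {g} p → mk≈ λ m → trans (coeff-neg f m)
                    (trans (cong ℚ.-_ (coeff-≡ p m)) (sym (coeff-neg g m)))
      }
    ; comm = λ f g → mk≈ λ m → trans (coeff-+ f g m)
               (trans (ℚ.+-comm (coeff f m) (coeff g m)) (sym (coeff-+ g f m)))
    }
  }
  where
  ≡⇒≈ : ∀ {f g : Poly n} → f ≡ g → f ≈ g
  ≡⇒≈ refl = mk≈ λ m → refl

-- The laws of addition, as +.assoc, +.trans, …
module + {n : ℕ} where
  open AbelianGroup (polyGroup n) public hiding (_≈_)
  open Algebra.Properties.AbelianGroup (polyGroup n) public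
  open Algebra.Properties.CommutativeSemigroup
    (AbelianGroup.commutativeSemigroup (polyGroup n)) public

term-0 : ∀ {n} (e : Monomial n) → (0ℚ , e) ∷ [] ≈ []
term-0 e = mk≈ λ m → trans (ℚ.+-identityʳ _) (when-0 (does (e ≟ᵐ m)))

-- Additive maps out of Poly n

module _ {n p} {P : Monomial n → Set p} (P? : ∀ e → Dec (P e)) where

  -- The terms of f whose monomial satisfies P.
  restrict : Poly n → Poly n
  restrict = List.filter (P? ∘ proj₂)

  coeff-restrict : ∀ f m → coeff (restrict f) m ≡ when (does (P? m)) (coeff f m)
  coeff-restrict []            m = sym (when-0 (does (P? m)))
  coeff-restrict ((c , e) ∷ f) m = begin
    coeff (restrict ((c , e) ∷ f)) m                        ≡⟨ head ⟩
    when (does (e ≟ᵐ m)) (when (does (P? e)) c) ℚ.+ coeff (restrict f) m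
                                                            ≡⟨ cong₂ ℚ._+_ swap (coeff-restrict f m) ⟩
    when (does (P? m)) (when (does (e ≟ᵐ m)) c) ℚ.+ when (does (P? m)) (coeff f m)
                                                            ≡⟨ when-+ (does (P? m)) _ _ ⟨
    when (does (P? m)) (coeff ((c , e) ∷ f) m)              ∎
    where
    open ≡-Reasoning

    head : coeff (restrict ((c , e) ∷ f)) m
         ≡ when (does (e ≟ᵐ m)) (when (does (P? e)) c) ℚ.+ coeff (restrict f) m
    head with does (P? e)
    ... | true  = refl
    ... | false = sym (trans (cong (ℚ._+ coeff (restrict f) m) (when-0 (does (e ≟ᵐ m)))) (ℚ.+-identityˡ _))

    swap : when (does (e ≟ᵐ m)) (when (does (P? e)) c) ≡ when (does (P? m)) (when (does (e ≟ᵐ m)) c)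
    swap with e ≟ᵐ m
    ... | yes refl = refl
    ... | no  _    = sym (when-0 (does (P? m)))

  restrict-cong : ∀ {f g} → f ≈ g → restrict f ≈ restrict g
  restrict-cong {f} {g} p = mk≈ λ m → trans (coeff-restrict f m)
    (trans (cong (when (does (P? m))) (coeff-≡ p m)) (sym (coeff-restrict g m)))

-- The terms of f with a monomial other than e.
infixl 6 _∖_
_∖_ : ∀ {n} → Poly n → Monomial n → Poly n
f ∖ e = restrict (λ e′ → ¬? (e′ ≟ᵐ e)) f

-- A map h on terms which is additive in the coefficient extends to an
-- additive map on formal sums of terms.  The extension respects _≈_, which
-- is the way to define functions on polynomials.
module Extension {n a ℓ} (A : AbelianGroup a ℓ)
  (h : ℚ × Monomial n → AbelianGroup.Carrier A)
  (h-+ : ∀ c d e → AbelianGroup._≈_ A (h (c ℚ.+ d , e)) (AbelianGroup._∙_ A (h (c , e)) (h (d , e))))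
  where

  open AbelianGroup A hiding (_-_)
    renaming (_≈_ to _≋_; refl to ≋-refl; sym to ≋-sym; trans to ≋-trans)
  open ≈-Reasoning setoid
  open Algebra.Properties.AbelianGroup A 
    using (identityʳ-unique; inverseʳ-unique; x∙y⁻¹≈ε⇒x≈y)
  open Algebra.Properties.CommutativeSemigroup commutativeSemigroup
    using (x∙yz≈y∙xz)

  extend : Poly n → Carrier
  extend = List.foldr (λ t s → h t ∙ s) ε

  extend-+ : ∀ f g → extend (f + g) ≋ extend f ∙ extend g
  extend-+ []      g = ≋-sym (identityˡ _)
  extend-+ (t ∷ f) g = begin
    h t ∙ extend (f + g)        ≈⟨ ∙-congˡ (extend-+ f g) ⟩
    h t ∙ (extend f ∙ extend g) ≈⟨ assoc _ _ _ ⟨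
    h t ∙ extend f ∙ extend g   ∎

  h-0 : ∀ e → h (0ℚ , e) ≋ ε
  h-0 e = identityʳ-unique _ _ (≋-sym (h-+ 0ℚ 0ℚ e))

  h-neg : ∀ c e → h (ℚ.- c , e) ≋ h (c , e) ⁻¹
  h-neg c e = inverseʳ-unique _ _ (begin
    h (c , e) ∙ h (ℚ.- c , e) ≈⟨ h-+ c (ℚ.- c) e ⟨
    h (c ℚ.- c , e)           ≡⟨ cong (λ d → h (d , e)) (ℚ.+-inverseʳ c) ⟩
    h (0ℚ , e)                ≈⟨ h-0 e ⟩
    ε                         ∎)

  extend-neg : ∀ f → extend (- f) ≋ extend f ⁻¹
  extend-neg f = inverseʳ-unique _ _ (go f)
    where
    go : ∀ f → extend f ∙ extend (- f) ≋ ε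
    go []            = identityˡ ε
    go ((c , e) ∷ f) = begin
      h (c , e) ∙ extend f ∙ (h (ℚ.- c , e) ∙ extend (- f))   ≈⟨ x∙yz≈y∙xz _ _ _ ⟩
      h (ℚ.- c , e) ∙ (h (c , e) ∙ extend f ∙ extend (- f))   ≈⟨ ∙-congˡ (assoc _ _ _) ⟩
      h (ℚ.- c , e) ∙ (h (c , e) ∙ (extend f ∙ extend (- f)))
        ≈⟨ ∙-cong (h-neg c e) (∙-congˡ (go f)) ⟩
      h (c , e) ⁻¹ ∙ (h (c , e) ∙ ε)                          ≈⟨ ∙-congˡ (identityʳ _) ⟩
      h (c , e) ⁻¹ ∙ h (c , e)                                ≈⟨ inverseˡ _ ⟩
      ε                                                       ∎

  extend-∖ : ∀ f e → extend f ≋ h (coeff f e , e) ∙ extend (f ∖ e)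
  extend-∖ []             e = ≋-sym (≋-trans (identityʳ _) (h-0 e))
  extend-∖ ((c , e′) ∷ f) e with e′ ≟ᵐ e
  ... | yes refl = begin
    h (c , e) ∙ extend f                                    ≈⟨ ∙-congˡ (extend-∖ f e) ⟩
    h (c , e) ∙ (h (coeff f e , e) ∙ extend (f ∖ e))        ≈⟨ assoc _ _ _ ⟨
    h (c , e) ∙ h (coeff f e , e) ∙ extend (f ∖ e)          ≈⟨ ∙-congʳ (h-+ c _ e) ⟨
    h (c ℚ.+ coeff f e , e) ∙ extend (f ∖ e)                ∎
  ... | no _ = begin
    h (c , e′) ∙ extend f                                   ≈⟨ ∙-congˡ (extend-∖ f e) ⟩
    h (c , e′) ∙ (h (coeff f e , e) ∙ extend (f ∖ e))       ≈⟨ x∙yz≈y∙xz _ _ _ ⟩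
    h (coeff f e , e) ∙ (h (c , e′) ∙ extend (f ∖ e))
      ≡⟨ cong (λ d → h (d , e) ∙ (h (c , e′) ∙ extend (f ∖ e))) (ℚ.+-identityˡ _) ⟨
    h (0ℚ ℚ.+ coeff f e , e) ∙ (h (c , e′) ∙ extend (f ∖ e)) ∎

  -- Induction on the number of terms: the terms whose monomial is the first
  -- one contribute h (0ℚ , e), and the others still form the polynomial 0.
  extend-≈0 : ∀ {f} → f ≈ [] → extend f ≋ ε
  extend-≈0 {f} = go (length f) f ℕ.≤-refl
    where
    go : ∀ k f → length f ℕ.≤ k → f ≈ [] → extend f ≋ ε
    go k       []            _         _   = ≋-refl
    go (suc k) ((c , e) ∷ f) (s≤s len) f≈0 = begin
      extend F                              ≈⟨ extend-∖ F e ⟩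
      h (coeff F e , e) ∙ extend (F ∖ e)
        ≡⟨ cong (λ d → h (d , e) ∙ extend (F ∖ e)) (coeff-≡ f≈0 e) ⟩
      h (0ℚ , e) ∙ extend (F ∖ e)
        ≈⟨ ∙-cong (h-0 e) (go k (F ∖ e) shorter (restrict-cong (λ e′ → ¬? (e′ ≟ᵐ e)) {F} f≈0)) ⟩
      ε ∙ ε                                 ≈⟨ identityˡ ε ⟩
      ε                                     ∎
      where
      F = (c , e) ∷ f

      shorter : length (F ∖ e) ℕ.≤ k
      shorter with e ≟ᵐ e
      ... | yes _  = ℕ.≤-trans (List.length-filter _ f) len
      ... | no e≢e = contradiction refl e≢e

  extend-cong : ∀ {f g} → f ≈ g → extend f ≋ extend g
  extend-cong {f} {g} f≈g = x∙y⁻¹≈ε⇒x≈y _ _ (begin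
    extend f ∙ extend g ⁻¹  ≈⟨ ∙-congˡ (extend-neg g) ⟨
    extend f ∙ extend (- g) ≈⟨ extend-+ f (- g) ⟨
    extend (f - g)          ≈⟨ extend-≈0 (+.x≈y⇒x∙y⁻¹≈ε f≈g) ⟩
    ε                       ∎)

-- The ring of polynomials

-- The product of a term and a polynomial.
infixr 7 _·_
_·_ : ∀ {n} → ℚ × Monomial n → Poly n → Poly n
(c , e) · g = List.map (λ (c′ , e′) → c ℚ.* c′ , e +ᵐ e′) g

coeff-· : ∀ {n} c e (g : Poly n) m → coeff ((c , e) · g) m ≡ c ℚ.* coeff ((1ℚ , e) · g) m
coeff-· c e []              m = sym (ℚ.*-zeroʳ c)
coeff-· c e ((c′ , e′) ∷ g) m = begin
  when b (c ℚ.* c′) ℚ.+ coeff ((c , e) · g) m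
    ≡⟨ cong₂ ℚ._+_ (when-* b c c′) (coeff-· c e g m) ⟩
  c ℚ.* when b c′ ℚ.+ c ℚ.* coeff ((1ℚ , e) · g) m                ≡⟨ ℚ.*-distribˡ-+ c _ _ ⟨
  c ℚ.* (when b c′ ℚ.+ coeff ((1ℚ , e) · g) m)
    ≡⟨ cong (λ d → c ℚ.* (when b d ℚ.+ coeff ((1ℚ , e) · g) m)) (ℚ.*-identityˡ c′) ⟨
  c ℚ.* (when b (1ℚ ℚ.* c′) ℚ.+ coeff ((1ℚ , e) · g) m)           ∎
  where
  open ≡-Reasoning
  b = does ((e +ᵐ e′) ≟ᵐ m)

·-distrib-+ : ∀ {n} (g : Poly n) c d e → (c ℚ.+ d , e) · g ≈ (c , e) · g + (d , e) · g
·-distrib-+ g c d e = mk≈ λ m → begin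
  coeff ((c ℚ.+ d , e) · g) m                             ≡⟨ coeff-· (c ℚ.+ d) e g m ⟩
  (c ℚ.+ d) ℚ.* coeff ((1ℚ , e) · g) m                    ≡⟨ ℚ.*-distribʳ-+ _ c d ⟩
  c ℚ.* coeff ((1ℚ , e) · g) m ℚ.+ d ℚ.* coeff ((1ℚ , e) · g) m
    ≡⟨ cong₂ ℚ._+_ (coeff-· c e g m) (coeff-· d e g m) ⟨
  coeff ((c , e) · g) m ℚ.+ coeff ((d , e) · g) m         ≡⟨ coeff-+ ((c , e) · g) _ m ⟨
  coeff ((c , e) · g + (d , e) · g) m                     ∎
  where open ≡-Reasoning

module Multiplication {n : ℕ} where
  private
    module ⟦_⟧* (g : Poly n) = Extension (polyGroup n) (_· g) (·-distrib-+ g)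

    extend-* : ∀ f g → ⟦_⟧*.extend g f ≡ f * g
    extend-* []      g = refl
    extend-* (t ∷ f) g = cong (t · g +_) (extend-* f g)

  *-congʳ : ∀ {f f′} g → f ≈ f′ → f * g ≈ f′ * g
  *-congʳ {f} {f′} g p = begin
    f * g             ≡⟨ extend-* f g ⟨
    ⟦_⟧*.extend g f   ≈⟨ ⟦_⟧*.extend-cong g p ⟩
    ⟦_⟧*.extend g f′  ≡⟨ extend-* f′ g ⟩
    f′ * g            ∎
    where open ≈-Reasoning +.setoid

  *-distribʳ : ∀ (h f g : Poly n) → (f + g) * h ≡ f * h + g * h
  *-distribʳ h f g = List.cartesianProductWith-distribʳ-++ _ f g h

  *-∷ʳ : ∀ (g : Poly n) t f → g * (t ∷ f) ≈ t · g + g * f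
  *-∷ʳ []      t f = mk≈ λ m → refl
  *-∷ʳ ((c , e) ∷ g) (d , k) f = begin
    (c ℚ.* d , e +ᵐ k) ∷ (c , e) · f + g * ((d , k) ∷ f)
      ≡⟨ cong₂ (λ x y → (x , y) ∷ (c , e) · f + g * ((d , k) ∷ f)) (ℚ.*-comm c d) (Vec.zipWith-comm ℕ.+-comm e k) ⟩
    s ∷ [] + ((c , e) · f + g * ((d , k) ∷ f))
      ≈⟨ +.∙-congˡ {x = s ∷ []} (+.∙-congˡ {x = (c , e) · f} (*-∷ʳ g (d , k) f)) ⟩
    s ∷ [] + ((c , e) · f + ((d , k) · g + g * f))
      ≈⟨ +.∙-congˡ {x = s ∷ []} (+.x∙yz≈y∙xz ((c , e) · f) ((d , k) · g) (g * f)) ⟩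
    s ∷ [] + ((d , k) · g + ((c , e) · f + g * f))  ≡⟨⟩
    (d , k) · ((c , e) ∷ g) + ((c , e) ∷ g) * f     ∎
    where
    open ≈-Reasoning +.setoid
    s = d ℚ.* c , k +ᵐ e

  *-comm : ∀ (f g : Poly n) → f * g ≈ g * f
  *-comm []      g = mk≈ λ m → cong (λ f → coeff f m) (sym (List.cartesianProductWith-zeroʳ _ g))
  *-comm (t ∷ f) g = begin
    t · g + f * g ≈⟨ +.∙-congˡ {x = t · g} (*-comm f g) ⟩
    t · g + g * f ≈⟨ *-∷ʳ g t f ⟨
    g * (t ∷ f)   ∎
    where open ≈-Reasoning +.setoid

  ·-* : ∀ t (g h : Poly n) → (t · g) * h ≡ t · (g * h)
  ·-* t []      h = refl
  ·-* (c , e) ((d , k) ∷ g) h = trans (cong₂ _+_ (·-· h) (·-* (c , e) g h)) (sym (List.map-++ _ ((d , k) · h) (g * h)))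
    where
    ·-· : ∀ h → (c ℚ.* d , e +ᵐ k) · h ≡ (c , e) · (d , k) · h
    ·-· []            = refl
    ·-· ((b , l) ∷ h) = cong₂ _∷_ (cong₂ _,_ (ℚ.*-assoc c d b) (Vec.zipWith-assoc ℕ.+-assoc e k l)) (·-· h)

  *-assoc : ∀ (f g h : Poly n) → (f * g) * h ≡ f * (g * h)
  *-assoc []      g h = refl
  *-assoc (t ∷ f) g h = trans (*-distribʳ h (t · g) (f * g)) (cong₂ _+_ (·-* t g h) (*-assoc f g h))

  *-identityˡ : ∀ (f : Poly n) → con 1ℚ * f ≡ f
  *-identityˡ f = trans (List.++-identityʳ _) (go f)
    where
    go : ∀ f → (1ℚ , Vec.replicate n 0) · f ≡ f
    go []            = refl
    go ((c , e) ∷ f) = cong₂ _∷_ (cong₂ _,_ (ℚ.*-identityˡ c) (Vec.zipWith-identityˡ ℕ.+-identityˡ e)) (go f)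

-- The zero polynomial is the empty sum.
polyRing : ℕ → CommutativeRing 0ℓ 0ℓ
polyRing n = record
  { Carrier = Poly n ; _≈_ = _≈_ ; _+_ = _+_ ; _*_ = _*_ ; -_ = -_ ; 0# = [] ; 1# = con 1ℚ
  ; isCommutativeRing = record
    { isRing = record
      { +-isAbelianGroup = +.isAbelianGroup
      ; *-cong = λ {f} {f′} {g} {g′} p q → begin
          f * g    ≈⟨ *-congʳ g p ⟩
          f′ * g   ≈⟨ *-comm f′ g ⟩
          g * f′   ≈⟨ *-congʳ f′ q ⟩
          g′ * f′  ≈⟨ *-comm g′ f′ ⟩
          f′ * g′  ∎
      ; *-assoc = λ f g h → +.reflexive (*-assoc f g h)
      ; *-identity = (λ f → +.reflexive (*-identityˡ f))
                   , (λ f → +.trans (*-comm f (con 1ℚ)) (+.reflexive (*-identityˡ f)))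
      ; distrib = (λ h f g → begin
                      h * (f + g)   ≈⟨ *-comm h (f + g) ⟩
                      (f + g) * h   ≡⟨ *-distribʳ h f g ⟩
                      f * h + g * h ≈⟨ +.∙-cong (*-comm f h) (*-comm g h) ⟩
                      h * f + h * g ∎)
                , (λ h f g → +.reflexive (*-distribʳ h f g))
      }
    ; *-comm = *-comm
    }
  }
  where
  open Multiplication
  open ≈-Reasoning +.setoid

-- Commutative ℚ-algebras and evaluation of polynomials

-- A commutative ring with its structure map ι from ℚ.
record ℚAlgebra : Set₁ where
  field
    commutativeRing : CommutativeRing 0ℓ 0ℓ
  private module R = CommutativeRing commutativeRing
  field
    ι   : ℚ → R.Carrier
    ι-+ : ∀ c d → ι (c ℚ.+ d) R.≈ ι c R.+ ι d
    ι-* : ∀ c d → ι (c ℚ.* d) R.≈ ι c R.* ι d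
    ι-1 : ι 1ℚ R.≈ R.1#
  open CommutativeRing commutativeRing public renaming (_≈_ to _≋_)
  open Algebra.Properties.CommutativeSemiring.Exp commutativeSemiring public

-- Homomorphisms of ℚ-algebras.
record Homomorphism (A B : ℚAlgebra) : Set where
  private
    module A = ℚAlgebra A
    module B = ℚAlgebra B
  field
    ⟦_⟧     : A.Carrier → B.Carrier
    ⟦⟧-cong : ∀ {a b} → a A.≋ b → ⟦ a ⟧ B.≋ ⟦ b ⟧
    +-homo  : ∀ a b → ⟦ a A.+ b ⟧ B.≋ ⟦ a ⟧ B.+ ⟦ b ⟧
    *-homo  : ∀ a b → ⟦ a A.* b ⟧ B.≋ ⟦ a ⟧ B.* ⟦ b ⟧
    ι-homo  : ∀ c → ⟦ A.ι c ⟧ B.≋ B.ι c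

  open ≈-Reasoning B.setoid

  1-homo : ⟦ A.1# ⟧ B.≋ B.1#
  1-homo = begin
    ⟦ A.1# ⟧    ≈⟨ ⟦⟧-cong A.ι-1 ⟨
    ⟦ A.ι 1ℚ ⟧  ≈⟨ ι-homo 1ℚ ⟩
    B.ι 1ℚ      ≈⟨ B.ι-1 ⟩
    B.1#        ∎

  0-homo : ⟦ A.0# ⟧ B.≋ B.0#
  0-homo = identityʳ-unique _ _ (begin
    ⟦ A.0# ⟧ B.+ ⟦ A.0# ⟧ ≈⟨ +-homo A.0# A.0# ⟨
    ⟦ A.0# A.+ A.0# ⟧     ≈⟨ ⟦⟧-cong (A.+-identityˡ A.0#) ⟩
    ⟦ A.0# ⟧              ∎)
    where open Algebra.Properties.AbelianGroup B.+-abelianGroup using (identityʳ-unique)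

  neg-homo : ∀ a → ⟦ A.- a ⟧ B.≋ B.- ⟦ a ⟧
  neg-homo a = inverseʳ-unique _ _ (begin
    ⟦ a ⟧ B.+ ⟦ A.- a ⟧ ≈⟨ +-homo a (A.- a) ⟨
    ⟦ a A.- a ⟧         ≈⟨ ⟦⟧-cong (A.-‿inverseʳ a) ⟩
    ⟦ A.0# ⟧            ≈⟨ 0-homo ⟩
    B.0#                ∎)
    where open Algebra.Properties.AbelianGroup B.+-abelianGroup using (inverseʳ-unique)

  ^-homo : ∀ a k → ⟦ a A.^ k ⟧ B.≋ ⟦ a ⟧ B.^ k
  ^-homo a zero    = 1-homo
  ^-homo a (suc k) = B.trans (*-homo a _) (B.*-congˡ (^-homo a k))

  -- Images of composite expressions from images of their parts.
  infixl 6 _⟨+⟩_ _⟨-⟩_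
  infixl 7 _⟨*⟩_
  infixr 8 _⟨^⟩_

  _⟨+⟩_ : ∀ {a b a′ b′} → ⟦ a ⟧ B.≋ a′ → ⟦ b ⟧ B.≋ b′ → ⟦ a A.+ b ⟧ B.≋ a′ B.+ b′
  p ⟨+⟩ q = B.trans (+-homo _ _) (B.+-cong p q)

  _⟨-⟩_ : ∀ {a b a′ b′} → ⟦ a ⟧ B.≋ a′ → ⟦ b ⟧ B.≋ b′ → ⟦ a A.- b ⟧ B.≋ a′ B.- b′
  p ⟨-⟩ q = p ⟨+⟩ B.trans (neg-homo _) (B.-‿cong q)

  _⟨*⟩_ : ∀ {a b a′ b′} → ⟦ a ⟧ B.≋ a′ → ⟦ b ⟧ B.≋ b′ → ⟦ a A.* b ⟧ B.≋ a′ B.* b′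
  p ⟨*⟩ q = B.trans (*-homo _ _) (B.*-cong p q)

  _⟨^⟩_ : ∀ {a a′} → ⟦ a ⟧ B.≋ a′ → ∀ k → ⟦ a A.^ k ⟧ B.≋ a′ B.^ k
  p ⟨^⟩ k = B.trans (^-homo _ k) (B.^-congˡ k p)

_∘ʰ_ : ∀ {A B C} → Homomorphism B C → Homomorphism A B → Homomorphism A C
_∘ʰ_ {C = C} β α = record
  { ⟦_⟧     = β.⟦_⟧ ∘ α.⟦_⟧
  ; ⟦⟧-cong = β.⟦⟧-cong ∘ α.⟦⟧-cong
  ; +-homo  = λ a b → C.trans (β.⟦⟧-cong (α.+-homo a b)) (β.+-homo _ _)
  ; *-homo  = λ a b → C.trans (β.⟦⟧-cong (α.*-homo a b)) (β.*-homo _ _)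
  ; ι-homo  = λ c → C.trans (β.⟦⟧-cong (α.ι-homo c)) (β.ι-homo c)
  }
  where
  module C = ℚAlgebra C
  module α = Homomorphism α
  module β = Homomorphism β

-- The polynomial ring in n variables.
poly : ℕ → ℚAlgebra
poly n = record
  { commutativeRing = polyRing n
  ; ι   = con
  ; ι-+ = λ c d → mk≈ λ m → trans (cong (ℚ._+ 0ℚ) (when-+ (does (Vec.replicate n 0 ≟ᵐ m)) c d))
                                  (ℚ.+-assoc (when (does (Vec.replicate n 0 ≟ᵐ m)) c) _ 0ℚ)
  ; ι-* = λ c d → +.reflexive (cong (λ e → (c ℚ.* d , e) ∷ []) (sym (Vec.zipWith-identityˡ ℕ.+-identityˡ _)))
  ; ι-1 = +.refl
  }

-- Evaluation at a vector F of elements of a ℚ-algebra.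
module Evaluation (A : ℚAlgebra) {n} (F : Vec (ℚAlgebra.Carrier A) n) where
  open ℚAlgebra A renaming (_+_ to _+ᴬ_; _*_ to _*ᴬ_; _^_ to _^ᴬ_; refl to ≋-refl; sym to ≋-sym; trans to ≋-trans)
    hiding (_-_; -_; zero)
  open Algebra.Properties.CommutativeSemigroup *-commutativeSemigroup using (interchange)
  open ≈-Reasoning setoid

  monomial : ∀ {k} → Vec Carrier k → Monomial k → Carrier
  monomial F e = Vec.foldr′ _*ᴬ_ 1# (Vec.zipWith _^ᴬ_ F e)

  monomial-0 : ∀ {k} (F : Vec Carrier k) → monomial F (Vec.replicate k 0) ≋ 1#
  monomial-0 []      = ≋-refl
  monomial-0 (a ∷ F) = ≋-trans (*-identityˡ _) (monomial-0 F)

  monomial-unit : ∀ {k} (F : Vec Carrier k) i → monomial F (Vec.replicate k 0 [ i ]≔ 1) ≋ lookup F i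
  monomial-unit (a ∷ F) zero    = ≋-trans (*-congˡ (monomial-0 F)) (≋-trans (*-identityʳ _) (*-identityʳ a))
  monomial-unit (a ∷ F) (suc i) = ≋-trans (*-identityˡ _) (monomial-unit F i)

  monomial-+ : ∀ {k} (F : Vec Carrier k) e e′ → monomial F (e +ᵐ e′) ≋ monomial F e *ᴬ monomial F e′
  monomial-+ []      []      []        = ≋-sym (*-identityˡ 1#)
  monomial-+ (a ∷ F) (x ∷ e) (x′ ∷ e′) =
    ≋-trans (*-cong (^-homo-* a x x′) (monomial-+ F e e′)) (interchange _ _ _ _)

  term : ℚ × Monomial n → Carrier
  term (c , e) = ι c *ᴬ monomial F e

  open Extension +-abelianGroup term (λ c d e → ≋-trans (*-congʳ (ι-+ c d)) (distribʳ _ _ _)) public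
    renaming (extend to ev; extend-+ to ev-+; extend-cong to ev-cong)
    using ()

  ev-· : ∀ t g → ev (t · g) ≋ term t *ᴬ ev g
  ev-· t       []              = ≋-sym (zeroʳ _)
  ev-· (c , e) ((c′ , e′) ∷ g) = begin
    ι (c ℚ.* c′) *ᴬ monomial F (e +ᵐ e′) +ᴬ ev ((c , e) · g)
      ≈⟨ +-cong (*-cong (ι-* c c′) (monomial-+ F e e′)) (ev-· (c , e) g) ⟩
    (ι c *ᴬ ι c′) *ᴬ (monomial F e *ᴬ monomial F e′) +ᴬ term (c , e) *ᴬ ev g
      ≈⟨ +-congʳ (interchange _ _ _ _) ⟩
    term (c , e) *ᴬ term (c′ , e′) +ᴬ term (c , e) *ᴬ ev g
      ≈⟨ distribˡ _ _ _ ⟨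
    term (c , e) *ᴬ ev ((c′ , e′) ∷ g) ∎

  ev-* : ∀ f g → ev (f * g) ≋ ev f *ᴬ ev g
  ev-* []      g = ≋-sym (zeroˡ _)
  ev-* (t ∷ f) g = begin
    ev (t · g + f * g)               ≈⟨ ev-+ (t · g) (f * g) ⟩
    ev (t · g) +ᴬ ev (f * g)         ≈⟨ +-cong (ev-· t g) (ev-* f g) ⟩
    term t *ᴬ ev g +ᴬ ev f *ᴬ ev g   ≈⟨ distribʳ _ _ _ ⟨
    ev (t ∷ f) *ᴬ ev g               ∎

  ev-con : ∀ c → ev (con c) ≋ ι c
  ev-con c = ≋-trans (+-identityʳ _) (≋-trans (*-congˡ (monomial-0 F)) (*-identityʳ _))

  ev-var : ∀ i → ev (var i) ≋ lookup F i
  ev-var i = ≋-trans (+-identityʳ _) (≋-trans (*-cong ι-1 (monomial-unit F i)) (*-identityˡ _))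

  evʰ : Homomorphism (poly n) A
  evʰ = record { ⟦_⟧ = ev ; ⟦⟧-cong = ev-cong ; +-homo = ev-+ ; *-homo = ev-* ; ι-homo = ev-con }

open Evaluation public using (evʰ)

-- Powers of polynomials and powers in a semiring are two recursive functions,
-- which agree only propositionally.
ev≡⟪⟫ : ∀ {n m} (F : Vec (Poly m) n) f → Evaluation.ev (poly m) F f ≡ f ⟪ F ⟫
ev≡⟪⟫ F []            = refl
ev≡⟪⟫ {m = m} F ((c , e) ∷ f) = cong₂ (λ M g → con c * M + g) (monomials F e) (ev≡⟪⟫ F f)
  where
  open Algebra.Properties.CommutativeSemiring.Exp (ℚAlgebra.commutativeSemiring (poly m))
    using () renaming (_^_ to _^′_)

  powers : ∀ (g : Poly m) x → g ^′ x ≡ g ^ x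
  powers g zero    = refl
  powers g (suc x) = cong (g *_) (powers g x)

  monomials : ∀ {k} (G : Vec (Poly m) k) e → ∏ (Vec.zipWith _^′_ G e) ≡ ∏ (Vec.zipWith _^_ G e)
  monomials []      []      = refl
  monomials (g ∷ G) (x ∷ e) = cong₂ _*_ (powers g x) (monomials G e)

-- The homomorphism f ↦ f ⟪ F ⟫.
substitution : ∀ {n m} → Vec (Poly m) n → Homomorphism (poly n) (poly m)
substitution {n} {m} F = record
  { ⟦_⟧     = _⟪ F ⟫
  ; ⟦⟧-cong = λ {f} {g} p → subst₂ _≈_ (ev≡⟪⟫ F f) (ev≡⟪⟫ F g) (E.⟦⟧-cong p)
  ; +-homo  = λ f g → subst₂ _≈_ (ev≡⟪⟫ F (f + g)) (cong₂ _+_ (ev≡⟪⟫ F f) (ev≡⟪⟫ F g)) (E.+-homo f g)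
  ; *-homo  = λ f g → subst₂ _≈_ (ev≡⟪⟫ F (f * g)) (cong₂ _*_ (ev≡⟪⟫ F f) (ev≡⟪⟫ F g)) (E.*-homo f g)
  ; ι-homo  = λ c → subst (_≈ con c) (ev≡⟪⟫ F (con c)) (E.ι-homo c)
  }
  where module E = Homomorphism (evʰ (poly m) F)

var-⟪⟫ : ∀ {n m} (F : Vec (Poly m) n) i → var i ⟪ F ⟫ ≈ lookup F i
var-⟪⟫ {m = m} F i = subst (_≈ lookup F i) (ev≡⟪⟫ F (var i)) (Evaluation.ev-var (poly m) F i)

module _ {A B} (α : Homomorphism A B) where
  private
    module A = ℚAlgebra A
    module B = ℚAlgebra B
  open Homomorphism α
  open Evaluation using (ev; term; monomial)

  -- A homomorphism commutes with evaluation of polynomials.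
  ev-natural : ∀ {n} (F : Vec A.Carrier n) (G : Vec B.Carrier n) →
    (∀ i → ⟦ lookup F i ⟧ B.≋ lookup G i) → ∀ f → ⟦ ev A F f ⟧ B.≋ ev B G f
  ev-natural F G F≋G []            = 0-homo
  ev-natural F G F≋G ((c , e) ∷ f) = begin
    ⟦ term A F (c , e) A.+ ev A F f ⟧       ≈⟨ +-homo _ _ ⟩
    ⟦ term A F (c , e) ⟧ B.+ ⟦ ev A F f ⟧   ≈⟨ B.+-cong (*-homo _ _) (ev-natural F G F≋G f) ⟩
    ⟦ A.ι c ⟧ B.* ⟦ monomial A F F e ⟧ B.+ ev B G f
      ≈⟨ B.+-congʳ (B.*-cong (ι-homo c) (go F G F≋G e)) ⟩
    term B G (c , e) B.+ ev B G f           ∎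
    where
    open ≈-Reasoning B.setoid
    go : ∀ {k} (F′ : Vec A.Carrier k) (G′ : Vec B.Carrier k) → (∀ i → ⟦ lookup F′ i ⟧ B.≋ lookup G′ i) →
         ∀ e → ⟦ monomial A F F′ e ⟧ B.≋ monomial B G G′ e
    go []       []       p []      = 1-homo
    go (a ∷ F′) (b ∷ G′) p (x ∷ e) = B.trans (*-homo _ _)
      (B.*-cong (B.trans (^-homo a x) (B.^-congˡ x (p zero))) (go F′ G′ (p ∘ suc) e))

module _ {n : ℕ} where
  open CommutativeRing (polyRing n) using (*-cong; setoid)
  open ≈-Reasoning setoid

  private
    mono : Monomial n → Poly n
    mono e = (1ℚ , e) ∷ []

    0ᵐ : ∀ {k} → Monomial k
    0ᵐ = Vec.replicate _ 0

    0ᵐ+ : ∀ {k} (e : Monomial k) → 0ᵐ +ᵐ e ≡ e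
    0ᵐ+ = Vec.zipWith-identityˡ ℕ.+-identityˡ

    -- A monomial in the variables is the product of its powers of variables.
    -- The additive map j embeds exponent vectors of length k, so that the
    -- induction on k can pass to the last variables.
    vars-monomial : ∀ {k} (j : Monomial k → Monomial n) → j 0ᵐ ≡ 0ᵐ →
      (∀ e e′ → j (e +ᵐ e′) ≡ j e +ᵐ j e′) →
      ∀ e → ∏ (Vec.zipWith _^_ (Vec.tabulate (λ i → mono (j (0ᵐ [ i ]≔ 1)))) e) ≈ mono (j e)
    vars-monomial j j-0 j-+ []      = +.reflexive (cong mono (sym j-0))
    vars-monomial j j-0 j-+ (x ∷ e) = begin
      mono (j (1 ∷ 0ᵐ)) ^ x * tail
        ≈⟨ *-cong {u = tail} (power x) (vars-monomial (j ∘ (0 ∷_)) j-0 (λ e e′ → j-+ (0 ∷ e) (0 ∷ e′)) e) ⟩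
      mono (j (x ∷ 0ᵐ)) * mono (j (0 ∷ e))  ≡⟨ cong mono (j-+ (x ∷ 0ᵐ) (0 ∷ e)) ⟨
      mono (j (x ℕ.+ 0 ∷ 0ᵐ +ᵐ e)) ≡⟨ cong₂ (λ y e → mono (j (y ∷ e))) (ℕ.+-identityʳ x) (0ᵐ+ e) ⟩
      mono (j (x ∷ e))                      ∎
      where
      tail : Poly n
      tail = ∏ (Vec.zipWith _^_ (Vec.tabulate (λ i → mono (j (0 ∷ 0ᵐ [ i ]≔ 1)))) e)

      power : ∀ x → mono (j (1 ∷ 0ᵐ)) ^ x ≈ mono (j (x ∷ 0ᵐ))
      power zero    = +.reflexive (cong mono (sym j-0))
      power (suc x) = begin
        mono (j (1 ∷ 0ᵐ)) * mono (j (1 ∷ 0ᵐ)) ^ x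
          ≈⟨ *-cong (+.refl {x = mono (j (1 ∷ 0ᵐ))}) (power x) ⟩
        mono (j (1 ∷ 0ᵐ)) * mono (j (x ∷ 0ᵐ))        ≡⟨ cong mono (j-+ (1 ∷ 0ᵐ) (x ∷ 0ᵐ)) ⟨
        mono (j (suc x ∷ 0ᵐ +ᵐ 0ᵐ))   ≡⟨ cong (λ e → mono (j (suc x ∷ e))) (0ᵐ+ 0ᵐ) ⟩
        mono (j (suc x ∷ 0ᵐ))                        ∎

  ⟪vars⟫ : ∀ (f : Poly n) → f ⟪ vars ⟫ ≈ f
  ⟪vars⟫ []            = +.refl
  ⟪vars⟫ ((c , e) ∷ f) = +.∙-cong {x = con c * ∏ (Vec.zipWith _^_ vars e)} {y = (c , e) ∷ []} {u = f ⟪ vars ⟫} {v = f} (begin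
    con c * ∏ (Vec.zipWith _^_ vars e)
      ≈⟨ *-cong (+.refl {x = con c}) (vars-monomial (λ e → e) refl (λ _ _ → refl) e) ⟩
    con c * mono e                     ≡⟨ cong₂ (λ d k → (d , k) ∷ []) (ℚ.*-identityʳ c) (0ᵐ+ e) ⟩
    (c , e) ∷ []                       ∎)
    (⟪vars⟫ f)

module _ {n m} (α : Homomorphism (poly n) (poly m)) where
  open Homomorphism α

  poly-^-homo : ∀ f {g} → ⟦ f ⟧ ≈ g → ∀ k → ⟦ f ^ k ⟧ ≈ g ^ k
  poly-^-homo f     p zero    = 1-homo
  poly-^-homo f {g} p (suc k) = +.trans (*-homo f (f ^ k)) (CommutativeRing.*-cong (polyRing m) p (poly-^-homo f p k))

-- Homomorphisms out of Poly n are determined by the images of the variables.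
module _ {n B} (α β : Homomorphism (poly n) B) where
  private
    module α = Homomorphism α
    module β = Homomorphism β
    module B = ℚAlgebra B

  hom-unique : (∀ i → α.⟦ var i ⟧ B.≋ β.⟦ var i ⟧) → ∀ f → α.⟦ f ⟧ B.≋ β.⟦ f ⟧
  hom-unique α≋β f = begin
    α.⟦ f ⟧             ≈⟨ α.⟦⟧-cong (⟪vars⟫ f) ⟨
    α.⟦ f ⟪ vars ⟫ ⟧    ≡⟨ cong α.⟦_⟧ (ev≡⟪⟫ vars f) ⟨
    α.⟦ Evaluation.ev (poly n) vars f ⟧ ≈⟨ ev-natural α vars G α-vars f ⟩
    Evaluation.ev B G f ≈⟨ ev-natural β vars G β-vars f ⟨
    β.⟦ Evaluation.ev (poly n) vars f ⟧ ≡⟨ cong β.⟦_⟧ (ev≡⟪⟫ vars f) ⟩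
    β.⟦ f ⟪ vars ⟫ ⟧    ≈⟨ β.⟦⟧-cong (⟪vars⟫ f) ⟩
    β.⟦ f ⟧             ∎
    where
    open ≈-Reasoning B.setoid

    G : Vec B.Carrier n
    G = Vec.map α.⟦_⟧ vars

    α-vars : ∀ i → α.⟦ lookup vars i ⟧ B.≋ lookup G i
    α-vars i = B.reflexive (sym (Vec.lookup-map i α.⟦_⟧ vars))

    α≋β′ : ∀ i → α.⟦ lookup vars i ⟧ B.≋ β.⟦ lookup vars i ⟧
    α≋β′ i rewrite Vec.lookup∘tabulate {n = n} var i = α≋β i

    β-vars : ∀ i → β.⟦ lookup vars i ⟧ B.≋ lookup G i
    β-vars i = B.trans (B.sym (α≋β′ i)) (α-vars i)

-- Equality of explicit polynomials by computation

-- The monomial m is listed in f, perhaps with coefficients that sum to 0.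
Occurs : ∀ {n} → Monomial n → Poly n → Set
Occurs m = Any (λ t → proj₂ t ≡ m)

occurs⊎coeff-0 : ∀ {n} (f : Poly n) m → Occurs m f ⊎ coeff f m ≡ 0ℚ
occurs⊎coeff-0 []            m = inj₂ refl
occurs⊎coeff-0 ((c , e) ∷ f) m with e ≟ᵐ m
... | yes p = inj₁ (here p)
... | no  _ = Sum.map there (trans (ℚ.+-identityˡ _)) (occurs⊎coeff-0 f m)

-- The coefficients agree at the finitely many listed monomials.
CoeffsAgree : ∀ {n} → Poly n → Poly n → Set
CoeffsAgree f g = All (λ t → coeff f (proj₂ t) ≡ coeff g (proj₂ t)) (f + g)

coeffsAgree? : ∀ {n} (f g : Poly n) → Dec (CoeffsAgree f g)
coeffsAgree? f g = All.all? (λ t → coeff f (proj₂ t) ℚ.≟ coeff g (proj₂ t)) (f + g)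

coeffsAgree⇒≈ : ∀ {n} (f g : Poly n) → CoeffsAgree f g → f ≈ g
coeffsAgree⇒≈ f g agree = mk≈ equal
  where
  at : ∀ {h} → All (λ t → coeff f (proj₂ t) ≡ coeff g (proj₂ t)) h →
       ∀ {m} → Occurs m h → coeff f m ≡ coeff g m
  at (p ∷ _)  (here refl) = p
  at (_ ∷ ps) (there o)   = at ps o

  equal : ∀ m → coeff f m ≡ coeff g m
  equal m with occurs⊎coeff-0 f m | occurs⊎coeff-0 g m
  ... | inj₁ o | _      = at agree (Any.++⁺ˡ o)
  ... | inj₂ _ | inj₁ o = at agree (Any.++⁺ʳ f o)
  ... | inj₂ p | inj₂ q = trans p (sym q)

by-computation : ∀ {n} (f g : Poly n) {_ : True (coeffsAgree? f g)} → f ≈ g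
by-computation f g {agree} = coeffsAgree⇒≈ f g (toWitness agree)

-- Leading terms

-- The lexicographic order on monomials.
infix 4 _<ᵐ_
_<ᵐ_ : ∀ {n} → Monomial n → Monomial n → Set
_<ᵐ_ = Lex-< _≡_ ℕ._<_

<ᵐ-trans : ∀ {n} {e m k : Monomial n} → e <ᵐ m → m <ᵐ k → e <ᵐ k
<ᵐ-trans = Lex.<-trans (IsEquivalence.isPartialEquivalence isEquivalence) (resp₂ ℕ._<_) ℕ.<-trans

<ᵐ-irrefl : ∀ {n} {e : Monomial n} → ¬ (e <ᵐ e)
<ᵐ-irrefl (this p _) = ℕ.<-irrefl refl p
<ᵐ-irrefl (next _ p) = <ᵐ-irrefl p

compare : ∀ {n} (e m : Monomial n) → e <ᵐ m ⊎ e ≡ m ⊎ m <ᵐ e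
compare e m with Lex.<-cmp sym ℕ.<-cmp e m
... | tri< p _ _ = inj₁ p
... | tri≈ _ p _ = inj₂ (inj₁ (Pointwise-≡⇒≡ p))
... | tri> _ _ p = inj₂ (inj₂ p)

+ᵐ-monoˡ : ∀ {n} (k : Monomial n) {e m} → e <ᵐ m → e +ᵐ k <ᵐ m +ᵐ k
+ᵐ-monoˡ (x ∷ k) (this p _)    = this (ℕ.+-monoˡ-< x p) refl
+ᵐ-monoˡ (x ∷ k) (next refl p) = next refl (+ᵐ-monoˡ k p)
+ᵐ-monoˡ []      (Lex.base ())

+ᵐ-monoʳ : ∀ {n} (k : Monomial n) {e m} → e <ᵐ m → k +ᵐ e <ᵐ k +ᵐ m
+ᵐ-monoʳ k {e} {m} p = subst₂ _<ᵐ_ (Vec.zipWith-comm ℕ.+-comm e k) (Vec.zipWith-comm ℕ.+-comm m k) (+ᵐ-monoˡ k p)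

-- All listed monomials are smaller than m.
Below : ∀ {n} → Monomial n → Poly n → Set
Below m = All (λ t → proj₂ t <ᵐ m)

coeff-Below : ∀ {n} {f : Poly n} {m} → Below m f → coeff f m ≡ 0ℚ
coeff-Below []                             = refl
coeff-Below {f = (c , e) ∷ f} {m} (p ∷ ps) with e ≟ᵐ m
... | yes refl = contradiction p <ᵐ-irrefl
... | no  _    = trans (ℚ.+-identityˡ _) (coeff-Below ps)

-- Either f is zero, or f has a leading term c · m with c ≠ 0.  The bound on the
-- length of the remainder serves the recursion in the next lemma.
data Leading {n} (f : Poly n) : Set where
  none : f ≈ [] → Leading f
  lead : ∀ c m f′ → c ≢ 0ℚ → Below m f′ → f ≈ (c , m) ∷ f′ →
         length f′ ℕ.< length f → Leading f

leading : ∀ {n} (f : Poly n) → Leading f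
leading f = go (length f) f ℕ.≤-refl
  where
  add-0 : ∀ {n} (t : ℚ × Monomial n) {f g} → f ≈ g → t ∷ f ≈ t ∷ g
  add-0 t = +.∙-congˡ {x = t ∷ []}

  swap : ∀ {n} (t u : ℚ × Monomial n) f → t ∷ u ∷ f ≈ u ∷ t ∷ f
  swap t u f = +.x∙yz≈y∙xz (t ∷ []) (u ∷ []) f

  merge : ∀ {n} c d (m : Monomial n) f → (c , m) ∷ (d , m) ∷ f ≈ (c ℚ.+ d , m) ∷ f
  merge c d m f = mk≈ λ k → let b = does (m ≟ᵐ k) in
    trans (sym (ℚ.+-assoc (when b c) (when b d) (coeff f k)))
          (cong (ℚ._+ coeff f k) (sym (when-+ b c d)))

  drop-0 : ∀ {n} (m : Monomial n) f → (0ℚ , m) ∷ f ≈ f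
  drop-0 m f = +.∙-congʳ {x = f} (term-0 m)

  go : ∀ {n} k (f : Poly n) → length f ℕ.≤ k → Leading f
  go k       []            _         = none +.refl
  go (suc k) ((c , e) ∷ f) (s≤s len) with c ℚ.≟ 0ℚ
  go (suc k) ((c , e) ∷ f) (s≤s len) | yes refl with go k f len
  ... | none p                = none (+.trans (drop-0 e f) p)
  ... | lead d m f′ d≢0 b p l = lead d m f′ d≢0 b (+.trans (drop-0 e f) p) (ℕ.m≤n⇒m≤1+n l)
  go (suc k) ((c , e) ∷ f) (s≤s len) | no c≢0 with go k f len
  ... | none p = lead c e [] c≢0 [] (add-0 (c , e) p) (s≤s z≤n)
  ... | lead d m f′ d≢0 b p l with compare e m
  ...   | inj₁ e<m = lead d m ((c , e) ∷ f′) d≢0 (e<m ∷ b)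
                       (+.trans (add-0 (c , e) p) (swap (c , e) (d , m) f′)) (s≤s l)
  ...   | inj₂ (inj₂ m<e) = lead c e ((d , m) ∷ f′) c≢0
                       (m<e ∷ All.map (λ q → <ᵐ-trans q m<e) b) (add-0 (c , e) p) (s≤s l)
  ...   | inj₂ (inj₁ refl) with c ℚ.+ d ℚ.≟ 0ℚ
  ...     | no c+d≢0 = lead (c ℚ.+ d) e f′ c+d≢0 b
                       (+.trans (add-0 (c , e) p) (merge c d e f′)) (ℕ.m≤n⇒m≤1+n l)
  -- The leading terms cancel, and the search continues in the remainder f′.
  ...     | yes c+d≡0 = cancelled (go k f′ (ℕ.≤-trans (ℕ.<⇒≤ l) len))
    where
    f≈f′ : (c , e) ∷ f ≈ f′
    f≈f′ = +.trans (add-0 (c , e) p) (+.trans (merge c d e f′)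
             (subst (λ b → (b , e) ∷ f′ ≈ f′) (sym c+d≡0) (drop-0 e f′)))

    cancelled : Leading f′ → Leading ((c , e) ∷ f)
    cancelled (none q)                  = none (+.trans f≈f′ q)
    cancelled (lead b m f″ b≢0 B q l′) = lead b m f″ b≢0 B (+.trans f≈f′ q)
                                           (ℕ.m≤n⇒m≤1+n (ℕ.<-trans l′ l))

ℚ-*-≢0 : ∀ {c d} → c ≢ 0ℚ → d ≢ 0ℚ → c ℚ.* d ≢ 0ℚ
ℚ-*-≢0 {c} {d} c≢0 d≢0 cd≡0 = d≢0 (begin
  d                    ≡⟨ ℚ.*-identityˡ d ⟨
  1ℚ ℚ.* d             ≡⟨ cong (ℚ._* d) (ℚ.*-inverseˡ c) ⟨
  (ℚ.1/ c) ℚ.* c ℚ.* d ≡⟨ ℚ.*-assoc (ℚ.1/ c) c d ⟩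
  (ℚ.1/ c) ℚ.* (c ℚ.* d) ≡⟨ cong ((ℚ.1/ c) ℚ.*_) cd≡0 ⟩
  (ℚ.1/ c) ℚ.* 0ℚ      ≡⟨ ℚ.*-zeroʳ (ℚ.1/ c) ⟩
  0ℚ                   ∎)
  where
  open ≡-Reasoning
  instance _ = ℚ.≢-nonZero c≢0

Below-· : ∀ {n} c (e : Monomial n) {m g} → Below m g → Below (e +ᵐ m) ((c , e) · g)
Below-· c e b = All.map⁺ (All.map (+ᵐ-monoʳ e) b)

module _ {n : ℕ} where
  open CommutativeRing (polyRing n) using (*-cong; *-comm; zeroˡ)

  -- The leading term of a product is the product of the leading terms, since
  -- the lexicographic order is compatible with multiplication of monomials.
  *-≉0 : ∀ {f g : Poly n} → ¬ (f ≈ []) → ¬ (g ≈ []) → ¬ (f * g ≈ [])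
  *-≉0 {f} {g} f≉0 g≉0 fg≈0 with leading f | leading g
  ... | none p | _      = f≉0 p
  ... | lead _ _ _ _ _ _ _ | none q = g≉0 q
  ... | lead c m f′ c≢0 below-f p _ | lead d k g′ d≢0 below-g q _ = ℚ-*-≢0 c≢0 d≢0 (begin
    c ℚ.* d                                         ≡⟨ top ⟨
    coeff (((c , m) ∷ f′) * ((d , k) ∷ g′)) (m +ᵐ k) ≡⟨ coeff-≡ (*-cong p q) (m +ᵐ k) ⟨
    coeff (f * g) (m +ᵐ k)                          ≡⟨ coeff-≡ fg≈0 (m +ᵐ k) ⟩
    0ℚ                                              ∎)
    where
    open ≡-Reasoning

    below-rest : ∀ f′ → Below m f′ → Below (m +ᵐ k) (f′ * ((d , k) ∷ g′))
    below-rest []            []       = []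
    below-rest ((b , e) ∷ f′) (e<m ∷ bs) = All.++⁺
      (+ᵐ-monoˡ k e<m ∷ All.map (λ l → <ᵐ-trans l (+ᵐ-monoˡ k e<m)) (Below-· b e below-g))
      (below-rest f′ bs)

    top : coeff (((c , m) ∷ f′) * ((d , k) ∷ g′)) (m +ᵐ k) ≡ c ℚ.* d
    top with (m +ᵐ k) ≟ᵐ (m +ᵐ k)
    ... | no ≢  = contradiction refl ≢
    ... | yes _ = trans (cong (c ℚ.* d ℚ.+_) (coeff-Below (All.++⁺ (Below-· c m below-g) (below-rest f′ below-f))))
                        (ℚ.+-identityʳ _)

  ≈0? : ∀ (f : Poly n) → Dec (f ≈ [])
  ≈0? f with leading f
  ... | none p = yes p
  ... | lead c m f′ c≢0 b p _ = no λ f≈0 → c≢0 (begin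
    c                      ≡⟨ ℚ.+-identityʳ c ⟨
    c ℚ.+ 0ℚ               ≡⟨ cong (c ℚ.+_) (coeff-Below b) ⟨
    c ℚ.+ coeff f′ m       ≡⟨ cong (ℚ._+ coeff f′ m) at-m ⟨
    coeff ((c , m) ∷ f′) m ≡⟨ coeff-≡ p m ⟨
    coeff f m              ≡⟨ coeff-≡ f≈0 m ⟩
    0ℚ                     ∎)
    where
    open ≡-Reasoning
    at-m : when (does (m ≟ᵐ m)) c ≡ c
    at-m with m ≟ᵐ m
    ... | yes _ = refl
    ... | no  ≢ = contradiction refl ≢

  *-≈0 : ∀ (f g : Poly n) → f * g ≈ [] → f ≈ [] ⊎ g ≈ []
  *-≈0 f g fg≈0 with ≈0? f | ≈0? g
  ... | yes p | _     = inj₁ p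
  ... | no  _ | yes q = inj₂ q
  ... | no  p | no  q = contradiction fg≈0 (*-≉0 p q)

  *-cancel-≈0 : ∀ {f g : Poly n} → ¬ (f ≈ []) → f * g ≈ [] → g ≈ []
  *-cancel-≈0 {f} {g} f≉0 fg≈0 with *-≈0 f g fg≈0
  ... | inj₁ p = contradiction p f≉0
  ... | inj₂ q = q

  ^-≉0 : ∀ {f : Poly n} → ¬ (f ≈ []) → ∀ k → ¬ (f ^ k ≈ [])
  ^-≉0 f≉0 zero    p = 1≉0 p
    where
    1≉0 : ¬ (con 1ℚ ≈ [])
    1≉0 p with Vec.replicate n 0 ≟ᵐ Vec.replicate n 0 | coeff-≡ p (Vec.replicate n 0)
    ... | yes _ | ()
    ... | no  ≢ | _ = contradiction refl ≢
  ^-≉0 f≉0 (suc k) = *-≉0 f≉0 (^-≉0 f≉0 k)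

-- Homogeneous components

-- Every listed term has degree d.  This is stronger than homogeneity, which
-- allows terms of other degrees that cancel.
Form : ∀ {n} → ℕ → Poly n → Set
Form d = All (λ t → Vec.sum (proj₂ t) ≡ d)

sum-0 : ∀ n → Vec.sum (Vec.replicate n 0) ≡ 0
sum-0 zero    = refl
sum-0 (suc n) = sum-0 n

sum-+ᵐ : ∀ {n} (e m : Monomial n) → Vec.sum (e +ᵐ m) ≡ Vec.sum e ℕ.+ Vec.sum m
sum-+ᵐ []      []      = refl
sum-+ᵐ (x ∷ e) (y ∷ m) = trans (cong (x ℕ.+ y ℕ.+_) (sum-+ᵐ e m)) (interchange x y (Vec.sum e) (Vec.sum m))
  where open Algebra.Properties.CommutativeSemigroup ℕ.+-commutativeSemigroup using (interchange)

Form-con : ∀ {n} c → Form 0 (con {n} c)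
Form-con {n} c = sum-0 n ∷ []

Form-* : ∀ {n d d′} {f g : Poly n} → Form d f → Form d′ g → Form (d ℕ.+ d′) (f * g)
Form-* []                     qs = []
Form-* {f = (c , e) ∷ f} (p ∷ ps) qs = All.++⁺
  (All.map⁺ (All.map (λ {t} q → trans (sum-+ᵐ e (proj₂ t)) (cong₂ ℕ._+_ p q)) qs)) (Form-* ps qs)

Form-^ : ∀ {n d} {f : Poly n} → Form d f → ∀ k → Form (d ℕ.* k) (f ^ k)
Form-^ {n} {d} p zero    = subst (λ b → Form b (con {n} 1ℚ)) (sym (ℕ.*-zeroʳ d)) (Form-con 1ℚ)
Form-^ {n} {d} {f} p (suc k) = subst (λ b → Form b (f ^ suc k)) (sym (ℕ.*-suc d k)) (Form-* p (Form-^ p k))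

Form-∏ : ∀ {n d k} (F : Vec (Poly n) k) → (∀ i → Form d (lookup F i)) →
         ∀ e → Form (d ℕ.* Vec.sum e) (∏ (Vec.zipWith _^_ F e))
Form-∏ {n} {d} []      p []      = subst (λ b → Form b (con {n} 1ℚ)) (sym (ℕ.*-zeroʳ d)) (Form-con 1ℚ)
Form-∏ {n} {d} (f ∷ F) p (x ∷ e) = subst (λ b → Form b (∏ (Vec.zipWith _^_ (f ∷ F) (x ∷ e))))
  (sym (ℕ.*-distribˡ-+ d x (Vec.sum e))) (Form-* (Form-^ (p zero) x) (Form-∏ F (p ∘ suc) e))

-- The homogeneous component of degree d.
component : ∀ {n} → ℕ → Poly n → Poly n
component d = restrict (λ e → Vec.sum e ℕ.≟ d)

Form-component : ∀ {n} d (f : Poly n) → Form d (component d f)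
Form-component d f = All.all-filter _ f

module _ {n m d} .{{_ : ℕ.NonZero d}} (F : Vec (Poly m) n) (F-form : ∀ i → Form d (lookup F i)) where

  -- Substitution of forms of degree d multiplies degrees by d, so it commutes
  -- with taking homogeneous components.
  component-⟪⟫ : ∀ k f → component (d ℕ.* k) (f ⟪ F ⟫) ≡ component k f ⟪ F ⟫
  component-⟪⟫ k []            = refl
  component-⟪⟫ k ((c , e) ∷ f) = trans (List.filter-++ _ (con c * M) (f ⟪ F ⟫)) split
    where
    M : Poly m
    M = ∏ (Vec.zipWith _^_ F e)

    M-form : Form (d ℕ.* Vec.sum e) (con c * M)
    M-form = Form-* (Form-con c) (Form-∏ F F-form e)

    split : component (d ℕ.* k) (con c * M) + component (d ℕ.* k) (f ⟪ F ⟫) ≡ component k ((c , e) ∷ f) ⟪ F ⟫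
    split with Vec.sum e ℕ.≟ k
    ... | yes refl = trans (cong₂ _+_ (List.filter-all _ M-form) (component-⟪⟫ k f))
                           (cong (_⟪ F ⟫) (sym (List.filter-accept _ {c , e} {f} refl)))
    ... | no  ≢k   = trans (cong₂ _+_ (List.filter-none _ (All.map (λ {t} p q → ≢k (ℕ.*-cancelˡ-≡ _ _ d (trans (sym p) q))) M-form))
                                      (component-⟪⟫ k f))
                           (cong (_⟪ F ⟫) (sym (List.filter-reject _ {c , e} {f} ≢k)))

-- A property that is closed under sums holds for f if it holds for the
-- homogeneous components of f, since f is their sum.
components-induction : ∀ {n} (P : Poly n → Set) →
  (∀ {f g} → f ≈ g → P f → P g) → P [] → (∀ {f g} → P f → P g → P (f + g)) →
  ∀ f → (∀ k → P (component k f)) → P f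
components-induction {n} P P-resp P-0 P-+ f P-comp = subst P truncated (P-below (bound f))
  where
  -- The sum of the components of degree less than k.
  below : ℕ → Poly n
  below k = restrict (λ e → Vec.sum e ℕ.<? k) f

  below-suc : ∀ k → component k f + below k ≈ below (suc k)
  below-suc k = mk≈ λ m → begin
    coeff (component k f + below k) m
      ≡⟨ coeff-+ (component k f) (below k) m ⟩
    coeff (component k f) m ℚ.+ coeff (below k) m
      ≡⟨ cong₂ ℚ._+_ (coeff-restrict (λ e → Vec.sum e ℕ.≟ k) f m) (coeff-restrict (λ e → Vec.sum e ℕ.<? k) f m) ⟩
    when (does (Vec.sum m ℕ.≟ k)) (coeff f m) ℚ.+ when (does (Vec.sum m ℕ.<? k)) (coeff f m)
      ≡⟨ cases (Vec.sum m ℕ.≟ k) (Vec.sum m ℕ.<? k) (Vec.sum m ℕ.<? suc k) (coeff f m) ⟩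
    when (does (Vec.sum m ℕ.<? suc k)) (coeff f m)
      ≡⟨ coeff-restrict (λ e → Vec.sum e ℕ.<? suc k) f m ⟨
    coeff (below (suc k)) m                                  ∎
    where
    open ≡-Reasoning
    cases : ∀ {s} (p : Dec (s ≡ k)) (q : Dec (s ℕ.< k)) (r : Dec (s ℕ.< suc k)) c →
            when (does p) c ℚ.+ when (does q) c ≡ when (does r) c
    cases (yes refl) (yes q) _       c = contradiction q (ℕ.<-irrefl refl)
    cases (yes refl) (no  _) (yes _) c = ℚ.+-identityʳ c
    cases (yes refl) (no  _) (no  r) c = contradiction ℕ.≤-refl r
    cases (no  _)    (yes _) (yes _) c = ℚ.+-identityˡ c
    cases (no  _)    (yes q) (no  r) c = contradiction (ℕ.m≤n⇒m≤1+n q) r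
    cases (no  p)    (no  q) (yes r) c = contradiction (ℕ.≤∧≢⇒< (ℕ.s≤s⁻¹ r) p) q
    cases (no  _)    (no  _) (no  _) c = refl

  P-below : ∀ k → P (below k)
  P-below zero    = subst P (sym (List.filter-none _ (All.universal (λ _ ()) f))) P-0
  P-below (suc k) = P-resp (below-suc k) (P-+ (P-comp k) (P-below k))

  -- A strict upper bound for the degrees of the terms.
  bound : Poly n → ℕ
  bound = List.foldr (λ t b → suc (Vec.sum (proj₂ t)) ℕ.⊔ b) 0

  truncated : below (bound f) ≡ f
  truncated = List.filter-all _ (go f)
    where
    go : ∀ f → All (λ t → Vec.sum (proj₂ t) ℕ.< bound f) f
    go []      = []
    go (t ∷ f) = ℕ.m≤m⊔n _ (bound f) ∷ All.map (λ p → ℕ.≤-trans p (ℕ.m≤n⊔m (suc (Vec.sum (proj₂ t))) _)) (go f)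

module _ (A : ℚAlgebra) {n : ℕ} where
  open ℚAlgebra A renaming (_+_ to _+ᴬ_; _*_ to _*ᴬ_; _^_ to _^ᴬ_; refl to ≋-refl; sym to ≋-sym; trans to ≋-trans)
    hiding (_-_; -_; zero)
  open Algebra.Properties.CommutativeSemigroup *-commutativeSemigroup using (interchange; x∙yz≈y∙xz)
  open ≈-Reasoning setoid
  open Evaluation A using (ev; monomial)

  -- A form of degree d satisfies f (M F) = M^d f (F).
  ev-scale : ∀ (F G : Vec Carrier n) M → (∀ i → lookup G i ≋ M *ᴬ lookup F i) →
             ∀ {d f} → Form d f → ev G f ≋ M ^ᴬ d *ᴬ ev F f
  ev-scale F G M G≋MF {d} []                        = ≋-sym (zeroʳ _)
  ev-scale F G M G≋MF {d} {f = (c , e) ∷ f} (p ∷ ps) = begin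
    ι c *ᴬ monomial G G e +ᴬ ev G f
      ≈⟨ +-cong (*-congˡ (monomials F G G≋MF e)) (ev-scale F G M G≋MF ps) ⟩
    ι c *ᴬ (M ^ᴬ Vec.sum e *ᴬ monomial F F e) +ᴬ M ^ᴬ d *ᴬ ev F f
      ≡⟨ cong (λ b → ι c *ᴬ (M ^ᴬ b *ᴬ monomial F F e) +ᴬ M ^ᴬ d *ᴬ ev F f) p ⟩
    ι c *ᴬ (M ^ᴬ d *ᴬ monomial F F e) +ᴬ M ^ᴬ d *ᴬ ev F f ≈⟨ +-congʳ (x∙yz≈y∙xz _ _ _) ⟩
    M ^ᴬ d *ᴬ (ι c *ᴬ monomial F F e) +ᴬ M ^ᴬ d *ᴬ ev F f ≈⟨ distribˡ _ _ _ ⟨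
    M ^ᴬ d *ᴬ ev F ((c , e) ∷ f) ∎
    where
    monomials : ∀ {k} (F′ G′ : Vec Carrier k) → (∀ i → lookup G′ i ≋ M *ᴬ lookup F′ i) →
                ∀ e → monomial G G′ e ≋ M ^ᴬ Vec.sum e *ᴬ monomial F F′ e
    monomials []       []       p []      = ≋-sym (*-identityˡ 1#)
    monomials (a ∷ F′) (b ∷ G′) p (x ∷ e) = begin
      b ^ᴬ x *ᴬ monomial G G′ e
        ≈⟨ *-cong (^-congˡ x (p zero)) (monomials F′ G′ (p ∘ suc) e) ⟩
      (M *ᴬ a) ^ᴬ x *ᴬ (M ^ᴬ Vec.sum e *ᴬ monomial F F′ e)        ≈⟨ *-congʳ (^-distrib-* M a x) ⟩
      M ^ᴬ x *ᴬ a ^ᴬ x *ᴬ (M ^ᴬ Vec.sum e *ᴬ monomial F F′ e)     ≈⟨ interchange _ _ _ _ ⟩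
      M ^ᴬ x *ᴬ M ^ᴬ Vec.sum e *ᴬ (a ^ᴬ x *ᴬ monomial F F′ e)
        ≈⟨ *-congʳ (^-homo-* M x (Vec.sum e)) ⟨
      M ^ᴬ Vec.sum (x ∷ e) *ᴬ monomial F (a ∷ F′) (x ∷ e)         ∎

-- Identities in commutative ℚ-algebras

-- The ring solver with rational coefficients; :ι c denotes the constant ι c.
module Solver (A : ℚAlgebra) where
  open ℚAlgebra A using (setoid; commutativeRing; 0#; _≋_; ι; ι-+; ι-*; ι-1; +-abelianGroup; reflexive)
    renaming (_+_ to _+ᴬ_; -_ to -ᴬ_; refl to ≋-refl; sym to ≋-sym; trans to ≋-trans)
  open Algebra.Properties.AbelianGroup +-abelianGroup using (identityʳ-unique; inverseʳ-unique)

  ι-0 : ι 0ℚ ≋ 0#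
  ι-0 = identityʳ-unique _ _ (≋-sym (ι-+ 0ℚ 0ℚ))

  private
    ι-neg : ∀ c → ι (ℚ.- c) ≋ -ᴬ ι c
    ι-neg c = inverseʳ-unique _ _ (≋-trans (≋-sym (ι-+ c (ℚ.- c)))
      (≋-trans (reflexive (cong ι (ℚ.+-inverseʳ c))) ι-0))

    target : AlmostCommutativeRing 0ℓ 0ℓ
    target = fromCommutativeRing commutativeRing

    ι-morphism : ℚ.+-*-rawRing -Raw-AlmostCommutative⟶ target
    ι-morphism = record
      { ⟦_⟧ = ι ; +-homo = ι-+ ; *-homo = ι-* ; -‿homo = ι-neg ; 0-homo = ι-0 ; 1-homo = ι-1 }

    ι-≟ : ∀ c d → Maybe (ι c ≋ ι d)
    ι-≟ c d = Maybe.map (reflexive ∘ cong ι) (dec⇒maybe (c ℚ.≟ d))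

  open Algebra.Solver.Ring ℚ.+-*-rawRing target ι-morphism ι-≟ public
    using (solve; _:=_; _:+_; _:*_; _:-_; :-_; _:^_)
    renaming (con to :ι)

-- Quotients of polynomial rings

-- The ideal generated by gs and the quotient by it.
module Ideal {n k} (gs : Vec (Poly n) k) where
  open CommutativeRing (polyRing n)
    using (+-cong; *-cong; zeroʳ; distribˡ; distribʳ; *-assoc; setoid)
  open ≈-Reasoning setoid
  open Algebra.Properties.CommutativeSemigroup
    (CommutativeRing.+-commutativeSemigroup (polyRing n)) using (interchange)

  private
    -- The sum of the products of the entries of hs and gs.
    combination : ∀ {k} → Vec (Poly n) k → Vec (Poly n) k → Poly n
    combination hs gs = ∑ (Vec.zipWith _*_ hs gs)

    combination-0 : ∀ {k} (gs : Vec (Poly n) k) → combination (Vec.replicate k []) gs ≡ []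
    combination-0 []       = refl
    combination-0 (g ∷ gs) = combination-0 gs

    combination-+ : ∀ {k} (hs hs′ gs : Vec (Poly n) k) →
      combination hs gs + combination hs′ gs ≈ combination (Vec.zipWith _+_ hs hs′) gs
    combination-+ []       []         []       = +.refl
    combination-+ (h ∷ hs) (h′ ∷ hs′) (g ∷ gs) = begin
      (h * g + combination hs gs) + (h′ * g + combination hs′ gs)
        ≈⟨ interchange (h * g) (combination hs gs) (h′ * g) _ ⟩
      (h * g + h′ * g) + (combination hs gs + combination hs′ gs)
        ≈⟨ +-cong (+.sym (distribʳ g h h′)) (combination-+ hs hs′ gs) ⟩
      (h + h′) * g + combination (Vec.zipWith _+_ hs hs′) gs        ∎

    combination-* : ∀ {k} f (hs gs : Vec (Poly n) k) →
      f * combination hs gs ≈ combination (Vec.map (f *_) hs) gs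
    combination-* f []       []       = zeroʳ f
    combination-* f (h ∷ hs) (g ∷ gs) = begin
      f * (h * g + combination hs gs)                     ≈⟨ distribˡ f (h * g) _ ⟩
      f * (h * g) + f * combination hs gs
        ≈⟨ +-cong (+.sym (*-assoc f h g)) (combination-* f hs gs) ⟩
      f * h * g + combination (Vec.map (f *_) hs) gs      ∎

  ∈-resp-≈ : ∀ {f g} → f ≈ g → f ∈⟨ gs ⟩ → g ∈⟨ gs ⟩
  ∈-resp-≈ p (hs , q) = hs , +.trans (+.sym p) q

  ∈-0 : [] ∈⟨ gs ⟩
  ∈-0 = Vec.replicate k [] , +.reflexive (sym (combination-0 gs))

  ∈-+ : ∀ {f g} → f ∈⟨ gs ⟩ → g ∈⟨ gs ⟩ → (f + g) ∈⟨ gs ⟩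
  ∈-+ (hs , p) (hs′ , q) = Vec.zipWith _+_ hs hs′ , +.trans (+-cong p q) (combination-+ hs hs′ gs)

  ∈-* : ∀ f {g} → g ∈⟨ gs ⟩ → (f * g) ∈⟨ gs ⟩
  ∈-* f (hs , q) = Vec.map (f *_) hs , +.trans (*-cong (+.refl {x = f}) q) (combination-* f hs gs)

  ∈-generator : ∀ i → lookup gs i ∈⟨ gs ⟩
  ∈-generator i = Vec.replicate k [] [ i ]≔ con 1ℚ , go i gs
    where
    go : ∀ {k} (i : Fin k) (gs : Vec (Poly n) k) → lookup gs i ≈ combination (Vec.replicate k [] [ i ]≔ con 1ℚ) gs
    go zero    (g ∷ gs) = +.reflexive (sym (trans (cong₂ _+_ (Multiplication.*-identityˡ g) (combination-0 gs)) (List.++-identityʳ g)))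
    go (suc i) (g ∷ gs) = go i gs

  -- Congruence modulo the ideal.
  infix 4 _∼_
  record _∼_ (f g : Poly n) : Set where
    constructor mk∼
    field
      difference : (f - g) ∈⟨ gs ⟩
  open _∼_ public

  ∈⇒∼0 : ∀ {f} → f ∈⟨ gs ⟩ → f ∼ []
  ∈⇒∼0 {f} p = mk∼ (∈-resp-≈ (+.reflexive (sym (List.++-identityʳ f))) p)

  ∼0⇒∈ : ∀ {f} → f ∼ [] → f ∈⟨ gs ⟩
  ∼0⇒∈ {f} (mk∼ p) = ∈-resp-≈ (+.reflexive (List.++-identityʳ f)) p

  ≈⇒∼ : ∀ {f g} → f ≈ g → f ∼ g
  ≈⇒∼ {f} {g} p = mk∼ (∈-resp-≈ (+.sym (+.x≈y⇒x∙y⁻¹≈ε p)) ∈-0)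

  -- The quotient ring: polynomials up to congruence.
  quotient : ℚAlgebra
  quotient = record
    { commutativeRing = record
      { Carrier = Poly n ; _≈_ = _∼_ ; _+_ = _+_ ; _*_ = _*_ ; -_ = -_ ; 0# = [] ; 1# = con 1ℚ
      ; isCommutativeRing = record
        { isRing = record
          { +-isAbelianGroup = record
            { isGroup = record
              { isMonoid = record
                { isSemigroup = record
                  { isMagma = record
                    { isEquivalence = record
                      { refl  = ≈⇒∼ +.refl
                      ; sym   = λ {f} {g} (mk∼ p) → mk∼ (∈-resp-≈ (sym-identity f g) (∈-* (- con 1ℚ) p))
                      ; trans = λ {f} {g} {h} (mk∼ p) (mk∼ q) → mk∼ (∈-resp-≈ (trans-identity f g h) (∈-+ p q))
                      }
                    ; ∙-cong = λ {f} {f′} {g} {g′} (mk∼ p) (mk∼ q) → mk∼ (∈-resp-≈ (+-identity f f′ g g′) (∈-+ p q))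
                    }
                  ; assoc = λ f g h → ≈⇒∼ (R.+-assoc f g h)
                  }
                ; identity = (λ f → ≈⇒∼ (R.+-identityˡ f)) , λ f → ≈⇒∼ (R.+-identityʳ f)
                }
              ; inverse = (λ f → ≈⇒∼ (R.-‿inverseˡ f)) , λ f → ≈⇒∼ (R.-‿inverseʳ f)
              ; ⁻¹-cong = λ {f} {g} (mk∼ p) → mk∼ (∈-resp-≈ (neg-identity f g) (∈-* (- con 1ℚ) p))
              }
            ; comm = λ f g → ≈⇒∼ (R.+-comm f g)
            }
          ; *-cong = λ {f} {f′} {g} {g′} (mk∼ p) (mk∼ q) → mk∼ (∈-resp-≈ (*-identity f f′ g g′) (∈-+ (∈-* g p) (∈-* f′ q)))
          ; *-assoc = λ f g h → ≈⇒∼ (R.*-assoc f g h)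
          ; *-identity = (λ f → ≈⇒∼ (R.*-identityˡ f)) , λ f → ≈⇒∼ (R.*-identityʳ f)
          ; distrib = (λ f g h → ≈⇒∼ (R.distribˡ f g h)) , λ f g h → ≈⇒∼ (R.distribʳ f g h)
          }
        ; *-comm = λ f g → ≈⇒∼ (R.*-comm f g)
        }
      }
    ; ι   = con
    ; ι-+ = λ c d → ≈⇒∼ (ℚAlgebra.ι-+ (poly n) c d)
    ; ι-* = λ c d → ≈⇒∼ (ℚAlgebra.ι-* (poly n) c d)
    ; ι-1 = ≈⇒∼ +.refl
    }
    where
    module R = CommutativeRing (polyRing n)
    open Solver (poly n)
    sym-identity : ∀ f g → - con 1ℚ * (f - g) ≈ g - f
    sym-identity = solve 2 (λ f g → :- :ι 1ℚ :* (f :- g) := g :- f) +.refl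
    trans-identity : ∀ f g h → (f - g) + (g - h) ≈ f - h
    trans-identity = solve 3 (λ f g h → (f :- g) :+ (g :- h) := f :- h) +.refl
    +-identity : ∀ f f′ g g′ → (f - f′) + (g - g′) ≈ (f + g) - (f′ + g′)
    +-identity = solve 4 (λ f f′ g g′ → (f :- f′) :+ (g :- g′) := (f :+ g) :- (f′ :+ g′)) +.refl
    neg-identity : ∀ f g → - con 1ℚ * (f - g) ≈ (- f) - (- g)
    neg-identity = solve 2 (λ f g → :- :ι 1ℚ :* (f :- g) := (:- f) :- (:- g)) +.refl
    *-identity : ∀ f f′ g g′ → g * (f - f′) + f′ * (g - g′) ≈ f * g - f′ * g′
    *-identity = solve 4 (λ f f′ g g′ → g :* (f :- f′) :+ f′ :* (g :- g′) := f :* g :- f′ :* g′) +.refl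

module _ {n k} (gs : Vec (Poly n) k) {B : ℚAlgebra} (α : Homomorphism (poly n) B) where
  open Homomorphism α
  open ℚAlgebra B using (_≋_; 0#; +-cong; *-congˡ; zeroʳ; +-identityˡ) renaming (trans to ≋-trans)

  -- A homomorphism that kills the generators kills the ideal.
  kills-ideal : (∀ i → ⟦ lookup gs i ⟧ ≋ 0#) → ∀ {f} → f ∈⟨ gs ⟩ → ⟦ f ⟧ ≋ 0#
  kills-ideal p (hs , q) = ≋-trans (⟦⟧-cong q) (go hs gs p)
    where
    go : ∀ {k} (hs gs : Vec (Poly n) k) → (∀ i → ⟦ lookup gs i ⟧ ≋ 0#) → ⟦ ∑ (Vec.zipWith _*_ hs gs) ⟧ ≋ 0#
    go []       []       p = 0-homo
    go (h ∷ hs) (g ∷ gs) p = ≋-trans (+-homo (h * g) (∑ (Vec.zipWith _*_ hs gs)))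
      (≋-trans (+-cong (≋-trans (*-homo h g) (≋-trans (*-congˡ (p zero)) (zeroʳ _))) (go hs gs (p ∘ suc)))
               (+-identityˡ 0#))

-- Regular elements

module _ (A : ℚAlgebra) where
  open ℚAlgebra A renaming (_*_ to _*ᴬ_; _^_ to _^ᴬ_; refl to ≋-refl; sym to ≋-sym; trans to ≋-trans)
    hiding (zero; _+_; _-_; -_)

  -- Not a zero divisor.
  Regular : Carrier → Set
  Regular p = ∀ {a} → p *ᴬ a ≋ 0# → a ≋ 0#

module _ {A : ℚAlgebra} where
  open ℚAlgebra A renaming (_*_ to _*ᴬ_; _^_ to _^ᴬ_; refl to ≋-refl; sym to ≋-sym; trans to ≋-trans)
    hiding (zero; _+_; _-_; -_)

  Regular-resp-≋ : ∀ {p q} → p ≋ q → Regular A p → Regular A q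
  Regular-resp-≋ p≋q reg qa≋0 = reg (≋-trans (*-congʳ p≋q) qa≋0)

  Regular-* : ∀ {p q} → Regular A p → Regular A q → Regular A (p *ᴬ q)
  Regular-* reg-p reg-q pqa≋0 = reg-q (reg-p (≋-trans (≋-sym (*-assoc _ _ _)) pqa≋0))

  Regular-^ : ∀ {p} → Regular A p → ∀ k → Regular A (p ^ᴬ k)
  Regular-^ reg zero    a≋0 = ≋-trans (≋-sym (*-identityˡ _)) a≋0
  Regular-^ {p} reg (suc k) = Regular-* {p} {p ^ᴬ k} reg (Regular-^ reg k)

  Regular-factorʳ : ∀ p q → Regular A (p *ᴬ q) → Regular A q
  Regular-factorʳ p q reg qa≋0 = reg (≋-trans (*-assoc p q _) (≋-trans (*-congˡ qa≋0) (zeroʳ p)))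

-- Quadratic extensions

module _ (A : ℚAlgebra) (g : ℚAlgebra.Carrier A) where
  open ℚAlgebra A renaming (_+_ to _+ᴬ_; _*_ to _*ᴬ_; -_ to -ᴬ_; refl to ≋-refl; sym to ≋-sym; trans to ≋-trans)
    hiding (zero; _-_; _^_)
  open Solver A

  -- Equality of pairs.  As a record type it is not unfolded into equalities of
  -- components.
  record _≋²_ (p q : Carrier × Carrier) : Set where
    constructor _,_
    field
      constant : proj₁ p ≋ proj₁ q
      linear   : proj₂ p ≋ proj₂ q

  ≋²-sym : ∀ {p q} → p ≋² q → q ≋² p
  ≋²-sym (p , q) = ≋-sym p , ≋-sym q

  -- A[t] / (t² - g), where the pair (a , b) stands for a + b t.
  quadratic : ℚAlgebra
  quadratic = record
    { commutativeRing = record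
      { Carrier = Carrier × Carrier
      ; _≈_ = _≋²_
      ; _+_ = λ (a , b) (a′ , b′) → a +ᴬ a′ , b +ᴬ b′
      ; _*_ = λ (a , b) (a′ , b′) → a *ᴬ a′ +ᴬ g *ᴬ (b *ᴬ b′) , a *ᴬ b′ +ᴬ b *ᴬ a′
      ; -_ = λ (a , b) → -ᴬ a , -ᴬ b
      ; 0# = 0# , 0#
      ; 1# = 1# , 0#
      ; isCommutativeRing = record
        { isRing = record
          { +-isAbelianGroup = record
            { isGroup = record
              { isMonoid = record
                { isSemigroup = record
                  { isMagma = record
                    { isEquivalence = record
                      { refl  = ≋-refl , ≋-refl
                      ; sym   = λ (p , q) → ≋-sym p , ≋-sym q
                      ; trans = λ (p , q) (p′ , q′) → ≋-trans p p′ , ≋-trans q q′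
                      }
                    ; ∙-cong = λ (p , p′) (q , q′) → +-cong p q , +-cong p′ q′
                    }
                  ; assoc = λ _ _ _ → +-assoc _ _ _ , +-assoc _ _ _
                  }
                ; identity = (λ _ → +-identityˡ _ , +-identityˡ _) , λ _ → +-identityʳ _ , +-identityʳ _
                }
              ; inverse = (λ _ → -‿inverseˡ _ , -‿inverseˡ _) , λ _ → -‿inverseʳ _ , -‿inverseʳ _
              ; ⁻¹-cong = λ (p , p′) → -‿cong p , -‿cong p′
              }
            ; comm = λ _ _ → +-comm _ _ , +-comm _ _
            }
          ; *-cong = λ (p , p′) (q , q′) →
              +-cong (*-cong p q) (*-congˡ (*-cong p′ q′)) , +-cong (*-cong p q′) (*-cong p′ q)
          ; *-assoc = λ (a , a′) (b , b′) (c , c′) →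
              solve 7 (λ g a a′ b b′ c c′ →
                (a :* b :+ g :* (a′ :* b′)) :* c :+ g :* ((a :* b′ :+ a′ :* b) :* c′) :=
                a :* (b :* c :+ g :* (b′ :* c′)) :+ g :* (a′ :* (b :* c′ :+ b′ :* c))) ≋-refl g a a′ b b′ c c′ ,
              solve 7 (λ g a a′ b b′ c c′ →
                (a :* b :+ g :* (a′ :* b′)) :* c′ :+ (a :* b′ :+ a′ :* b) :* c :=
                a :* (b :* c′ :+ b′ :* c) :+ a′ :* (b :* c :+ g :* (b′ :* c′))) ≋-refl g a a′ b b′ c c′
          ; *-identity =
              (λ (a , b) → embed-* (*-identityˡ a) (*-identityˡ b)) ,
              (λ (a , b) → ≋-trans (+-cong (*-identityʳ a) (≋-trans (*-congˡ (zeroʳ b)) (zeroʳ g))) (+-identityʳ a)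
                         , ≋-trans (+-cong (zeroʳ a) (*-identityʳ b)) (+-identityˡ b))
          ; distrib =
              (λ (a , a′) (b , b′) (c , c′) →
                solve 7 (λ g a a′ b b′ c c′ →
                  a :* (b :+ c) :+ g :* (a′ :* (b′ :+ c′)) :=
                  a :* b :+ g :* (a′ :* b′) :+ (a :* c :+ g :* (a′ :* c′))) ≋-refl g a a′ b b′ c c′ ,
                solve 6 (λ a a′ b b′ c c′ →
                  a :* (b′ :+ c′) :+ a′ :* (b :+ c) :=
                  a :* b′ :+ a′ :* b :+ (a :* c′ :+ a′ :* c)) ≋-refl a a′ b b′ c c′) ,
              (λ (a , a′) (b , b′) (c , c′) →
                solve 7 (λ g a a′ b b′ c c′ →
                  (b :+ c) :* a :+ g :* ((b′ :+ c′) :* a′) :=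
                  b :* a :+ g :* (b′ :* a′) :+ (c :* a :+ g :* (c′ :* a′))) ≋-refl g a a′ b b′ c c′ ,
                solve 6 (λ a a′ b b′ c c′ →
                  (b :+ c) :* a′ :+ (b′ :+ c′) :* a :=
                  b :* a′ :+ b′ :* a :+ (c :* a′ :+ c′ :* a)) ≋-refl a a′ b b′ c c′)
          }
        ; *-comm = λ (a , a′) (b , b′) →
            +-cong (*-comm a b) (*-congˡ (*-comm a′ b′)) ,
            ≋-trans (+-comm _ _) (+-cong (*-comm a′ b) (*-comm a b′))
        }
      }
    ; ι   = λ c → ι c , 0#
    ; ι-+ = λ c d → ι-+ c d , ≋-sym (+-identityˡ 0#)
    ; ι-* = λ c d → ≋²-sym (embed-* (≋-sym (ι-* c d)) (zeroʳ (ι c)))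
    ; ι-1 = ι-1 , ≋-refl
    }
    where
    -- The product of (a , 0) and (b , b′).
    embed-* : ∀ {a b b′ c c′} → a *ᴬ b ≋ c → a *ᴬ b′ ≋ c′ →
              (a *ᴬ b +ᴬ g *ᴬ (0# *ᴬ b′) , a *ᴬ b′ +ᴬ 0# *ᴬ b) ≋² (c , c′)
    embed-* {b = b} {b′} p q =
      ≋-trans (+-cong p (≋-trans (*-congˡ (zeroˡ b′)) (zeroʳ g))) (+-identityʳ _) ,
      ≋-trans (+-cong q (zeroˡ b)) (+-identityʳ _)

  embed : Homomorphism A quadratic
  embed = record
    { ⟦_⟧     = _, 0#
    ; ⟦⟧-cong = λ p → p , ≋-refl
    ; +-homo  = λ _ _ → ≋-refl , ≋-sym (+-identityˡ 0#)
    ; *-homo  = λ a b →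
        ≋-sym (≋-trans (+-congˡ (≋-trans (*-congˡ (zeroˡ 0#)) (zeroʳ g))) (+-identityʳ _)) ,
        ≋-sym (≋-trans (+-cong (zeroʳ a) (zeroˡ b)) (+-identityˡ 0#))
    ; ι-homo  = λ c → ≋-refl , ≋-refl
    }

  -- The adjoined square root of g.
  √ : Carrier × Carrier
  √ = 0# , 1#

  -- The extension is free over A with basis 1, t, so multiplication by an
  -- element of A acts on the two coefficients separately.
  embed-Regular : ∀ p → Regular A p → Regular quadratic (p , 0#)
  embed-Regular p reg {a , b} (q , r) =
    reg (≋-trans (≋-sym (≋-trans (+-congˡ (≋-trans (*-congˡ (zeroˡ b)) (zeroʳ g))) (+-identityʳ _))) q) ,
    reg (≋-trans (≋-sym (≋-trans (+-congˡ (zeroˡ a)) (+-identityʳ _))) r)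

  √-square : ℚAlgebra._*_ quadratic √ √ ≋² (g , 0#)
  √-square =
    ≋-trans (+-cong (zeroʳ 0#) (≋-trans (*-congˡ (*-identityʳ 1#)) (*-identityʳ g))) (+-identityˡ g) ,
    ≋-trans (+-cong (zeroˡ 1#) (zeroʳ 1#)) (+-identityˡ 0#)

  module _ {B : ℚAlgebra} (α : Homomorphism A B) (t : ℚAlgebra.Carrier B)
    (t² : ℚAlgebra._≋_ B (ℚAlgebra._*_ B t t) (Homomorphism.⟦_⟧ α g))
    where
    private
      module α = Homomorphism α
      module B = ℚAlgebra B
    open Solver B using () renaming (solve to solveᴮ; _:=_ to _:≐_; _:+_ to _:⊞_; _:*_ to _:⊠_)

    adjoin-embed : ∀ a → α.⟦ a ⟧ B.+ α.⟦ 0# ⟧ B.* t B.≋ α.⟦ a ⟧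
    adjoin-embed a = B.trans (B.+-congˡ (B.trans (B.*-congʳ α.0-homo) (B.zeroˡ t))) (B.+-identityʳ _)

    -- The extension of α that maps the square root of g to t.
    adjoin : Homomorphism quadratic B
    adjoin = record
      { ⟦_⟧     = λ (a , b) → α.⟦ a ⟧ B.+ α.⟦ b ⟧ B.* t
      ; ⟦⟧-cong = λ (p , q) → B.+-cong (α.⟦⟧-cong p) (B.*-congʳ (α.⟦⟧-cong q))
      ; +-homo  = λ (a , b) (a′ , b′) → B.trans
          (B.+-cong (α.+-homo a a′) (B.*-congʳ (α.+-homo b b′)))
          (solveᴮ 5 (λ a a′ b b′ t → (a :⊞ a′) :⊞ (b :⊞ b′) :⊠ t :≐ a :⊞ b :⊠ t :⊞ (a′ :⊞ b′ :⊠ t)) B.refl _ _ _ _ t)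
      ; *-homo  = λ (a , b) (a′ , b′) → B.trans
          (B.+-cong
            (B.trans (α.+-homo _ _) (B.+-cong (α.*-homo a a′)
              (B.trans (α.*-homo g _) (B.*-cong (B.sym t²) (α.*-homo b b′)))))
            (B.*-congʳ (B.trans (α.+-homo _ _) (B.+-cong (α.*-homo a b′) (α.*-homo b a′)))))
          (solveᴮ 5 (λ a a′ b b′ t → (a :⊠ a′ :⊞ (t :⊠ t) :⊠ (b :⊠ b′)) :⊞ (a :⊠ b′ :⊞ b :⊠ a′) :⊠ t
                                     :≐ (a :⊞ b :⊠ t) :⊠ (a′ :⊞ b′ :⊠ t)) B.refl _ _ _ _ t)
      ; ι-homo  = λ c → B.trans (adjoin-embed _) (α.ι-homo c)
      }

    adjoin-√ : α.⟦ 0# ⟧ B.+ α.⟦ 1# ⟧ B.* t B.≋ t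
    adjoin-√ = B.trans (B.+-cong α.0-homo (B.trans (B.*-congʳ α.1-homo) (B.*-identityˡ t))) (B.+-identityˡ t)

-- The coordinate ring of the cone over X

-- S is the polynomial ring in the coordinates of ℙ⁵, and I is the ideal of X.
S/I : ℚAlgebra
S/I = Ideal.quotient (eqs X)

module I = Ideal (eqs X)
open I using (_∼_)

-- The quotient map S → S / I, which is the identity on representatives.
projection : Homomorphism (poly 6) S/I
projection = record
  { ⟦_⟧ = λ f → f ; ⟦⟧-cong = I.≈⇒∼
  ; +-homo = λ f g → ℚAlgebra.refl S/I ; *-homo = λ f g → ℚAlgebra.refl S/I ; ι-homo = λ c → ℚAlgebra.refl S/I }

-- The positions of the homogeneous coordinates.
pattern x# = 0F
pattern y# = 1F
pattern u# = 2F
pattern v# = 3F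
pattern w# = 4F
pattern z# = 5F

-- The right hand sides of the equations u² = …, v² = …, w² = ….
module Squares (B : ℚAlgebra) where
  open ℚAlgebra B using (Carrier) renaming (_+_ to _+ᴮ_; _*_ to _*ᴮ_; _-_ to _-ᴮ_)

  u²-of v²-of w²-of : (x y z : Carrier) → Carrier
  u²-of x y z = (x +ᴮ y) *ᴮ z
  v²-of x y z = x *ᴮ y +ᴮ (x +ᴮ y) *ᴮ z
  w²-of x y z = x *ᴮ y -ᴮ (x +ᴮ y) *ᴮ z

module _ {A B} (α : Homomorphism A B) where
  private
    module A = Squares A
    module B = Squares B
  open Homomorphism α
  open ℚAlgebra B using (_≋_)

  u²-of-homo : ∀ x y z {x′ y′ z′} → ⟦ x ⟧ ≋ x′ → ⟦ y ⟧ ≋ y′ → ⟦ z ⟧ ≋ z′ →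
               ⟦ A.u²-of x y z ⟧ ≋ B.u²-of x′ y′ z′
  u²-of-homo x y z p q r = (p ⟨+⟩ q) ⟨*⟩ r

  v²-of-homo : ∀ x y z {x′ y′ z′} → ⟦ x ⟧ ≋ x′ → ⟦ y ⟧ ≋ y′ → ⟦ z ⟧ ≋ z′ →
               ⟦ A.v²-of x y z ⟧ ≋ B.v²-of x′ y′ z′
  v²-of-homo x y z p q r = p ⟨*⟩ q ⟨+⟩ u²-of-homo x y z p q r

  w²-of-homo : ∀ x y z {x′ y′ z′} → ⟦ x ⟧ ≋ x′ → ⟦ y ⟧ ≋ y′ → ⟦ z ⟧ ≋ z′ →
               ⟦ A.w²-of x y z ⟧ ≋ B.w²-of x′ y′ z′
  w²-of-homo x y z p q r = p ⟨*⟩ q ⟨-⟩ u²-of-homo x y z p q r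

-- The entries of a vector of homogeneous coordinates.
module Coordinates {A : Set} (F : Vec A 6) where
  x y u v w z : A
  x = lookup F 0F
  y = lookup F 1F
  u = lookup F 2F
  v = lookup F 3F
  w = lookup F 4F
  z = lookup F 5F

-- The points of the cone over X with values in B.
record Point (B : ℚAlgebra) : Set where
  private module B = ℚAlgebra B
  field
    coordinates : Vec B.Carrier 6
  open Coordinates coordinates public
  field
    u² : u B.* u B.≋ Squares.u²-of B x y z
    v² : v B.* v B.≋ Squares.v²-of B x y z
    w² : w B.* w B.≋ Squares.w²-of B x y z

module _ {B} (p : Point B) (α : Homomorphism (poly 6) B) where
  private module B = ℚAlgebra B
  open Homomorphism α
  open Point p

  quadrics-vanish : (∀ i → ⟦ var i ⟧ B.≋ lookup coordinates i) → ∀ i → ⟦ lookup (eqs X) i ⟧ B.≋ B.0#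
  quadrics-vanish α-var = λ
    { 0F → vanish (u²-of-homo α (var x#) (var y#) (var z#) α-x α-y α-z ⟨-⟩ α-u ⟨^⟩ 2) u²
    ; 1F → vanish (v²-of-homo α (var x#) (var y#) (var z#) α-x α-y α-z ⟨-⟩ α-v ⟨^⟩ 2) v²
    ; 2F → vanish (w²-of-homo α (var x#) (var y#) (var z#) α-x α-y α-z ⟨-⟩ α-w ⟨^⟩ 2) w²
    }
    where
    α-x = α-var x#
    α-y = α-var y#
    α-u = α-var u#
    α-v = α-var v#
    α-w = α-var w#
    α-z = α-var z#

    vanish : ∀ {f a t} → ⟦ f ⟧ B.≋ a B.- t B.^ 2 → t B.* t B.≋ a → ⟦ f ⟧ B.≋ B.0#
    vanish {f} {a} {t} q t² = begin
      ⟦ f ⟧            ≈⟨ q ⟩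
      a B.- t B.^ 2    ≈⟨ B.+-congʳ t² ⟨
      t B.* t B.- t B.^ 2 ≈⟨ solve 1 (λ t → t :* t :- t :^ 2 := :ι 0ℚ) B.refl t ⟩
      B.ι 0ℚ           ≈⟨ ι-0 ⟩
      B.0#             ∎
      where
      open ≈-Reasoning B.setoid
      open Solver B

-- The tower of quadratic extensions K₃ ⊇ K₂ ⊇ K₁ ⊇ K₀ = ℚ[x,y,z] in which u, v
-- and w are adjoined, and the homomorphism ν from S to K₃.
module Tower where
  -- The square roots of A, B and C are adjoined.
  x y z A B C : Poly 3
  x = var 0F
  y = var 1F
  z = var 2F
  A = Squares.u²-of (poly 3) x y z
  B = Squares.v²-of (poly 3) x y z
  C = Squares.w²-of (poly 3) x y z

  K₀ K₁ K₂ K₃ : ℚAlgebra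
  K₀ = poly 3
  K₁ = quadratic K₀ A
  K₂ = quadratic K₁ (B , [])
  K₃ = quadratic K₂ ((C , []) , [] , [])
  module K₃ = ℚAlgebra K₃

  embed₁ : Homomorphism K₀ K₁
  embed₁ = embed K₀ A
  embed₂ : Homomorphism K₁ K₂
  embed₂ = embed K₁ (B , [])
  embed₃ : Homomorphism K₂ K₃
  embed₃ = embed K₂ ((C , []) , [] , [])

  -- The inclusion of ℚ[x,y,z].
  base : Homomorphism K₀ K₃
  base = embed₃ ∘ʰ (embed₂ ∘ʰ embed₁)
  module base = Homomorphism base

  u v w : K₃.Carrier
  u = Homomorphism.⟦ embed₃ ∘ʰ embed₂ ⟧ (√ K₀ A)
  v = Homomorphism.⟦ embed₃ ⟧ (√ K₁ (B , []))
  w = √ K₂ ((C , []) , [] , [])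

  -- The adjoined square roots satisfy the equations of the cone.
  point : Point K₃
  point = record
    { coordinates = base.⟦ x ⟧ ∷ base.⟦ y ⟧ ∷ u ∷ v ∷ w ∷ base.⟦ z ⟧ ∷ []
    ; u² = K₃.trans (K₃.sym (Homomorphism.*-homo (embed₃ ∘ʰ embed₂) (√ K₀ A) (√ K₀ A)))
             (K₃.trans (Homomorphism.⟦⟧-cong (embed₃ ∘ʰ embed₂) (√-square K₀ A)) (u²-of-homo base x y z K₃.refl K₃.refl K₃.refl))
    ; v² = K₃.trans (K₃.sym (Homomorphism.*-homo embed₃ (√ K₁ (B , [])) (√ K₁ (B , []))))
             (K₃.trans (Homomorphism.⟦⟧-cong embed₃ (√-square K₁ (B , []))) (v²-of-homo base x y z K₃.refl K₃.refl K₃.refl))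
    ; w² = K₃.trans (√-square K₂ ((C , []) , [] , [])) (w²-of-homo base x y z K₃.refl K₃.refl K₃.refl)
    }

  -- Only the values of ν on the variables matter; unfolding ν leads to very
  -- large terms.
  opaque
    ν : Homomorphism (poly 6) K₃
    ν = evʰ K₃ (Point.coordinates point)

  module ν = Homomorphism ν

  opaque
    unfolding ν

    ν-var : ∀ i → ν.⟦ var i ⟧ K₃.≋ lookup (Point.coordinates point) i
    ν-var = Evaluation.ev-var K₃ (Point.coordinates point)

  ν-ideal : ∀ {f} → f ∈⟨ eqs X ⟩ → ν.⟦ f ⟧ K₃.≋ K₃.0#
  ν-ideal = kills-ideal (eqs X) ν (quadrics-vanish point ν ν-var)

-- The residue classes of the variables satisfy the equations of the cone.
tautological : Point S/I
tautological = record
  { coordinates = vars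
  ; u² = square (var u#) (I.∈⇒∼0 (I.∈-generator 0F))
  ; v² = square (var v#) (I.∈⇒∼0 (I.∈-generator 1F))
  ; w² = square (var w#) (I.∈⇒∼0 (I.∈-generator 2F))
  }
  where
  square : ∀ {a} t → a - t ^ 2 ∼ [] → t * t ∼ a
  square {a} t q = begin
    t * t                   ≈⟨ solve 2 (λ t a → t :* t := a :- (a :- t :^ 2)) Q.refl t a ⟩
    a - (a - t ^ 2)         ≈⟨ Q.+-congˡ {a} (Q.-‿cong {a - t ^ 2} {[]} q) ⟩
    a - []                  ≈⟨ Q.+-identityʳ a ⟩
    a                       ∎
    where
    module Q = ℚAlgebra S/I
    open Solver S/I
    open ≈-Reasoning Q.setoid

-- A left inverse of ν modulo I, built up along the tower.
module Freeness where
  open Tower hiding (x; y; z; u; v; w)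
  module Q = ℚAlgebra S/I
  module T = Point tautological

  -- The residue classes of polynomials in x, y and z.
  ρ₀ : Homomorphism K₀ S/I
  ρ₀ = evʰ S/I (T.x ∷ T.y ∷ T.z ∷ [])
  module ρ₀ = Homomorphism ρ₀

  ρ₀-var : ∀ i → ρ₀.⟦ var i ⟧ ∼ lookup (T.x ∷ T.y ∷ T.z ∷ []) i
  ρ₀-var = Evaluation.ev-var S/I (T.x ∷ T.y ∷ T.z ∷ [])

  private
    x y z : Poly 3
    x = Tower.x
    y = Tower.y
    z = Tower.z
    ρ₀x = ρ₀-var 0F
    ρ₀y = ρ₀-var 1F
    ρ₀z = ρ₀-var 2F

    u²∼ : T.u * T.u ∼ ρ₀.⟦ A ⟧
    u²∼ = Q.trans T.u² (Q.sym (u²-of-homo ρ₀ x y z ρ₀x ρ₀y ρ₀z))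

    v²∼ : T.v * T.v ∼ ρ₀.⟦ B ⟧
    v²∼ = Q.trans T.v² (Q.sym (v²-of-homo ρ₀ x y z ρ₀x ρ₀y ρ₀z))

    w²∼ : T.w * T.w ∼ ρ₀.⟦ C ⟧
    w²∼ = Q.trans T.w² (Q.sym (w²-of-homo ρ₀ x y z ρ₀x ρ₀y ρ₀z))

  -- ρ₁, ρ₂ and ρ₃ map the adjoined roots to the residue classes of u, v and w.
  ρ₁ : Homomorphism K₁ S/I
  ρ₁ = adjoin K₀ A ρ₀ T.u u²∼
  module ρ₁ = Homomorphism ρ₁

  ρ₁-embed : ∀ f → ρ₁.⟦ Homomorphism.⟦ embed₁ ⟧ f ⟧ ∼ ρ₀.⟦ f ⟧
  ρ₁-embed = adjoin-embed K₀ A ρ₀ T.u u²∼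

  private
    v²∼′ : T.v * T.v ∼ ρ₁.⟦ B , [] ⟧
    v²∼′ = Q.trans v²∼ (Q.sym (ρ₁-embed B))

  ρ₂ : Homomorphism K₂ S/I
  ρ₂ = adjoin K₁ (B , []) ρ₁ T.v v²∼′
  module ρ₂ = Homomorphism ρ₂

  ρ₂-embed : ∀ f → ρ₂.⟦ Homomorphism.⟦ embed₂ ⟧ f ⟧ ∼ ρ₁.⟦ f ⟧
  ρ₂-embed = adjoin-embed K₁ (B , []) ρ₁ T.v v²∼′

  private
    w²∼′ : T.w * T.w ∼ ρ₂.⟦ (C , []) , [] , [] ⟧
    w²∼′ = Q.trans w²∼ (Q.sym (Q.trans (ρ₂-embed (C , [])) (ρ₁-embed C)))

  ρ₃ : Homomorphism K₃ S/I
  ρ₃ = adjoin K₂ ((C , []) , [] , []) ρ₂ T.w w²∼′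
  module ρ₃ = Homomorphism ρ₃

  ρ₃-embed : ∀ f → ρ₃.⟦ Homomorphism.⟦ embed₃ ⟧ f ⟧ ∼ ρ₂.⟦ f ⟧
  ρ₃-embed = adjoin-embed K₂ ((C , []) , [] , []) ρ₂ T.w w²∼′

  ρ₃-base : ∀ f → ρ₃.⟦ base.⟦ f ⟧ ⟧ ∼ ρ₀.⟦ f ⟧
  ρ₃-base f = Q.trans (ρ₃-embed ((f , []) , [] , [])) (Q.trans (ρ₂-embed (f , [])) (ρ₁-embed f))

  ρ₃-coordinates : ∀ i → ρ₃.⟦ lookup (Point.coordinates point) i ⟧ ∼ var i
  ρ₃-coordinates x# = Q.trans (ρ₃-base x) ρ₀x
  ρ₃-coordinates y# = Q.trans (ρ₃-base y) ρ₀y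
  ρ₃-coordinates u# = Q.trans (ρ₃-embed (√ K₀ A , [] , [])) (Q.trans (ρ₂-embed (√ K₀ A)) (adjoin-√ K₀ A ρ₀ T.u u²∼))
  ρ₃-coordinates v# = Q.trans (ρ₃-embed (√ K₁ (B , []))) (adjoin-√ K₁ (B , []) ρ₁ T.v v²∼′)
  ρ₃-coordinates w# = adjoin-√ K₂ ((C , []) , [] , []) ρ₂ T.w w²∼′
  ρ₃-coordinates z# = Q.trans (ρ₃-base z) ρ₀z

  -- Both sides are homomorphisms from S to S / I, which agree on the variables.
  ρ₃-ν : ∀ f → ρ₃.⟦ ν.⟦ f ⟧ ⟧ ∼ f
  ρ₃-ν = hom-unique (ρ₃ ∘ʰ ν) projection λ i →
    Q.trans (ρ₃.⟦⟧-cong (ν-var i)) (ρ₃-coordinates i)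

  ν-injective : ∀ {f} → ν.⟦ f ⟧ K₃.≋ K₃.0# → f ∼ []
  ν-injective {f} p = Q.trans (Q.sym (ρ₃-ν f)) (Q.trans (ρ₃.⟦⟧-cong p) ρ₃.0-homo)

  base-Regular : ∀ p → ¬ (p ≈ []) → Regular K₃ base.⟦ p ⟧
  base-Regular p p≉0 = embed-Regular K₂ ((C , []) , [] , []) ((p , []) , [] , [])
    (embed-Regular K₁ (B , []) (p , []) (embed-Regular K₀ A p (λ {a} → *-cancel-≈0 {f = p} {a} p≉0)))

  -- Nonzero polynomials in x, y, z are regular on the coordinate ring.
  Regular-S/I : ∀ {f p} → ν.⟦ f ⟧ K₃.≋ base.⟦ p ⟧ → ¬ (p ≈ []) → Regular S/I f
  Regular-S/I {f} {p} νf p≉0 {a} fa∼0 = ν-injective (base-Regular p p≉0 (begin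
    base.⟦ p ⟧ K₃.* ν.⟦ a ⟧ ≈⟨ K₃.*-congʳ νf ⟨
    ν.⟦ f ⟧ K₃.* ν.⟦ a ⟧    ≈⟨ ν.*-homo f a ⟨
    ν.⟦ f * a ⟧             ≈⟨ ν-ideal (I.∼0⇒∈ fa∼0) ⟩
    K₃.0#                   ∎))
    where open ≈-Reasoning K₃.setoid

-- The parametrisation and its inverse

2ℚ 4ℚ 8ℚ 16ℚ : ℚ
2ℚ  = ℤ.+ 2 ℚ./ 1
4ℚ  = ℤ.+ 4 ℚ./ 1
8ℚ  = ℤ.+ 8 ℚ./ 1
16ℚ = ℤ.+ 16 ℚ./ 1

-- The parametrisation, homogenised by c and multiplied by the common
-- denominator 16 a⁴ l² c².  In affine terms P = 4a⁴ + 1, Q = 4a²l² + P,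
-- x = Q / (4a²) and y = P x / (4a²l²).
module Parametrisation (B : ℚAlgebra) (a l c : ℚAlgebra.Carrier B) where
  open ℚAlgebra B using (Carrier; ι) renaming (_+_ to _+ᴮ_; _*_ to _*ᴮ_; _-_ to _-ᴮ_; _^_ to _^ᴮ_)

  P Q : Carrier
  P = ι 4ℚ *ᴮ a ^ᴮ 4 +ᴮ c ^ᴮ 4
  Q = ι 4ℚ *ᴮ (a ^ᴮ 2 *ᴮ l ^ᴮ 2) +ᴮ P

  components : Vec Carrier 6
  components = ι 4ℚ *ᴮ (a ^ᴮ 2 *ᴮ l ^ᴮ 2) *ᴮ Q
             ∷ P *ᴮ Q
             ∷ ι 4ℚ *ᴮ (a ^ᴮ 2 *ᴮ (l *ᴮ c)) *ᴮ Q
             ∷ ι 2ℚ *ᴮ (a *ᴮ l) *ᴮ (ι 2ℚ *ᴮ a ^ᴮ 2 +ᴮ c ^ᴮ 2) *ᴮ Q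
             ∷ ι 2ℚ *ᴮ (a *ᴮ l) *ᴮ (ι 2ℚ *ᴮ a ^ᴮ 2 -ᴮ c ^ᴮ 2) *ᴮ Q
             ∷ ι 16ℚ *ᴮ (a ^ᴮ 4 *ᴮ (l ^ᴮ 2 *ᴮ c ^ᴮ 2))
             ∷ []

module _ {A B} (α : Homomorphism A B) where
  private
    module A = ℚAlgebra A
    module B = ℚAlgebra B
    module φᴬ = Parametrisation A
    module φᴮ = Parametrisation B
  open Homomorphism α

  -- The formulas commute with homomorphisms.
  parametrisation-homo : ∀ a l c {a′ l′ c′} →
    ⟦ a ⟧ B.≋ a′ → ⟦ l ⟧ B.≋ l′ → ⟦ c ⟧ B.≋ c′ →
    ∀ i → ⟦ lookup (φᴬ.components a l c) i ⟧ B.≋ lookup (φᴮ.components a′ l′ c′) i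
  parametrisation-homo a l c {a′} {l′} {c′} p q r = λ
    { x# → ι-homo 4ℚ ⟨*⟩ (p ⟨^⟩ 2 ⟨*⟩ q ⟨^⟩ 2) ⟨*⟩ Q-homo
    ; y# → P-homo ⟨*⟩ Q-homo
    ; u# → ι-homo 4ℚ ⟨*⟩ (p ⟨^⟩ 2 ⟨*⟩ (q ⟨*⟩ r)) ⟨*⟩ Q-homo
    ; v# → ι-homo 2ℚ ⟨*⟩ (p ⟨*⟩ q) ⟨*⟩ (ι-homo 2ℚ ⟨*⟩ p ⟨^⟩ 2 ⟨+⟩ r ⟨^⟩ 2) ⟨*⟩ Q-homo
    ; w# → ι-homo 2ℚ ⟨*⟩ (p ⟨*⟩ q) ⟨*⟩ (ι-homo 2ℚ ⟨*⟩ p ⟨^⟩ 2 ⟨-⟩ r ⟨^⟩ 2) ⟨*⟩ Q-homo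
    ; z# → ι-homo 16ℚ ⟨*⟩ (p ⟨^⟩ 4 ⟨*⟩ (q ⟨^⟩ 2 ⟨*⟩ r ⟨^⟩ 2))
    }
    where
    P-homo : ⟦ φᴬ.P a l c ⟧ B.≋ φᴮ.P a′ l′ c′
    P-homo = ι-homo 4ℚ ⟨*⟩ p ⟨^⟩ 4 ⟨+⟩ r ⟨^⟩ 4

    Q-homo : ⟦ φᴬ.Q a l c ⟧ B.≋ φᴮ.Q a′ l′ c′
    Q-homo = ι-homo 4ℚ ⟨*⟩ (p ⟨^⟩ 2 ⟨*⟩ q ⟨^⟩ 2) ⟨+⟩ P-homo

-- At (a : l : c) = (v + w : 2x : 2u) the parametrisation returns the given point
-- of the cone over X, multiplied by M.  The computation uses the relations
-- v² - w² = 2u² and v² + w² = 2xy.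
module Roundtrip {B} (p : Point B) where
  private
    module B = ℚAlgebra B
  open B using (ι; Carrier; _≋_) renaming (_+_ to _+ᴮ_; _*_ to _*ᴮ_; _-_ to _-ᴮ_; _^_ to _^ᴮ_)
  open Point p
  open Solver B
  open ≈-Reasoning B.setoid

  b : Carrier
  b = v +ᴮ w

  open Parametrisation B b (ι 2ℚ *ᴮ x) (ι 2ℚ *ᴮ u) public

  -- Q′ is the value of Q.
  Q′ M : Carrier
  Q′ = ι 16ℚ *ᴮ (b ^ᴮ 2 *ᴮ x) *ᴮ (x +ᴮ y)
  M  = ι 16ℚ *ᴮ (b ^ᴮ 2 *ᴮ x) *ᴮ Q′

  private
    2u² : ι 2ℚ *ᴮ (u *ᴮ u) ≋ v *ᴮ v -ᴮ w *ᴮ w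
    2u² = begin
      ι 2ℚ *ᴮ (u *ᴮ u)                  ≈⟨ B.*-congˡ u² ⟩
      ι 2ℚ *ᴮ ((x +ᴮ y) *ᴮ z)
        ≈⟨ solve 2 (λ s t → :ι 2ℚ :* s := t :+ s :- (t :- s)) B.refl ((x +ᴮ y) *ᴮ z) (x *ᴮ y) ⟩
      (x *ᴮ y +ᴮ (x +ᴮ y) *ᴮ z) -ᴮ (x *ᴮ y -ᴮ (x +ᴮ y) *ᴮ z) ≈⟨ B.+-cong v² (B.-‿cong w²) ⟨
      v *ᴮ v -ᴮ w *ᴮ w                  ∎

    2xy : ι 2ℚ *ᴮ (x *ᴮ y) ≋ v *ᴮ v +ᴮ w *ᴮ w
    2xy = begin
      ι 2ℚ *ᴮ (x *ᴮ y)
        ≈⟨ solve 2 (λ s t → :ι 2ℚ :* t := t :+ s :+ (t :- s)) B.refl ((x +ᴮ y) *ᴮ z) (x *ᴮ y) ⟩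
      (x *ᴮ y +ᴮ (x +ᴮ y) *ᴮ z) +ᴮ (x *ᴮ y -ᴮ (x +ᴮ y) *ᴮ z) ≈⟨ B.+-cong v² w² ⟨
      v *ᴮ v +ᴮ w *ᴮ w                  ∎

    P≋ : P ≋ ι 16ℚ *ᴮ (b ^ᴮ 2 *ᴮ (x *ᴮ y))
    P≋ = begin
      ι 4ℚ *ᴮ b ^ᴮ 4 +ᴮ (ι 2ℚ *ᴮ u) ^ᴮ 4
        ≈⟨ solve 2 (λ b u → :ι 4ℚ :* b :^ 4 :+ (:ι 2ℚ :* u) :^ 4
              := :ι 4ℚ :* b :^ 4 :+ :ι 4ℚ :* (:ι 2ℚ :* (u :* u)) :^ 2) B.refl b u ⟩
      ι 4ℚ *ᴮ b ^ᴮ 4 +ᴮ ι 4ℚ *ᴮ (ι 2ℚ *ᴮ (u *ᴮ u)) ^ᴮ 2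
        ≈⟨ B.+-congˡ (B.*-congˡ (B.^-congˡ 2 2u²)) ⟩
      ι 4ℚ *ᴮ b ^ᴮ 4 +ᴮ ι 4ℚ *ᴮ (v *ᴮ v -ᴮ w *ᴮ w) ^ᴮ 2
        ≈⟨ solve 2 (λ v w → :ι 4ℚ :* (v :+ w) :^ 4 :+ :ι 4ℚ :* (v :* v :- w :* w) :^ 2
                         := :ι 8ℚ :* ((v :+ w) :^ 2 :* (v :* v :+ w :* w))) B.refl v w ⟩
      ι 8ℚ *ᴮ (b ^ᴮ 2 *ᴮ (v *ᴮ v +ᴮ w *ᴮ w))
        ≈⟨ B.*-congˡ (B.*-congˡ 2xy) ⟨
      ι 8ℚ *ᴮ (b ^ᴮ 2 *ᴮ (ι 2ℚ *ᴮ (x *ᴮ y)))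
        ≈⟨ solve 2 (λ b t → :ι 8ℚ :* (b :^ 2 :* (:ι 2ℚ :* t))
              := :ι 16ℚ :* (b :^ 2 :* t)) B.refl b (x *ᴮ y) ⟩
      ι 16ℚ *ᴮ (b ^ᴮ 2 *ᴮ (x *ᴮ y)) ∎

    Q≋ : Q ≋ Q′
    Q≋ = B.trans (B.+-congˡ P≋)
      (solve 3 (λ b x y → :ι 4ℚ :* (b :^ 2 :* (:ι 2ℚ :* x) :^ 2) :+ :ι 16ℚ :* (b :^ 2 :* (x :* y))
                       := :ι 16ℚ :* (b :^ 2 :* x) :* (x :+ y)) B.refl b x y)

    2b²+c² : ι 2ℚ *ᴮ b ^ᴮ 2 +ᴮ (ι 2ℚ *ᴮ u) ^ᴮ 2 ≋ ι 4ℚ *ᴮ (b *ᴮ v)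
    2b²+c² = begin
      ι 2ℚ *ᴮ b ^ᴮ 2 +ᴮ (ι 2ℚ *ᴮ u) ^ᴮ 2
        ≈⟨ solve 2 (λ b u → :ι 2ℚ :* b :^ 2 :+ (:ι 2ℚ :* u) :^ 2
              := :ι 2ℚ :* b :^ 2 :+ :ι 2ℚ :* (:ι 2ℚ :* (u :* u))) B.refl b u ⟩
      ι 2ℚ *ᴮ b ^ᴮ 2 +ᴮ ι 2ℚ *ᴮ (ι 2ℚ *ᴮ (u *ᴮ u))
        ≈⟨ B.+-congˡ (B.*-congˡ 2u²) ⟩
      ι 2ℚ *ᴮ b ^ᴮ 2 +ᴮ ι 2ℚ *ᴮ (v *ᴮ v -ᴮ w *ᴮ w)
        ≈⟨ solve 2 (λ v w → :ι 2ℚ :* (v :+ w) :^ 2 :+ :ι 2ℚ :* (v :* v :- w :* w)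
              := :ι 4ℚ :* ((v :+ w) :* v)) B.refl v w ⟩
      ι 4ℚ *ᴮ (b *ᴮ v) ∎

    2b²-c² : ι 2ℚ *ᴮ b ^ᴮ 2 -ᴮ (ι 2ℚ *ᴮ u) ^ᴮ 2 ≋ ι 4ℚ *ᴮ (b *ᴮ w)
    2b²-c² = begin
      ι 2ℚ *ᴮ b ^ᴮ 2 -ᴮ (ι 2ℚ *ᴮ u) ^ᴮ 2
        ≈⟨ solve 2 (λ b u → :ι 2ℚ :* b :^ 2 :- (:ι 2ℚ :* u) :^ 2
              := :ι 2ℚ :* b :^ 2 :- :ι 2ℚ :* (:ι 2ℚ :* (u :* u))) B.refl b u ⟩
      ι 2ℚ *ᴮ b ^ᴮ 2 -ᴮ ι 2ℚ *ᴮ (ι 2ℚ *ᴮ (u *ᴮ u))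
        ≈⟨ B.+-congˡ (B.-‿cong (B.*-congˡ 2u²)) ⟩
      ι 2ℚ *ᴮ b ^ᴮ 2 -ᴮ ι 2ℚ *ᴮ (v *ᴮ v -ᴮ w *ᴮ w)
        ≈⟨ solve 2 (λ v w → :ι 2ℚ :* (v :+ w) :^ 2 :- :ι 2ℚ :* (v :* v :- w :* w)
              := :ι 4ℚ :* ((v :+ w) :* w)) B.refl v w ⟩
      ι 4ℚ *ᴮ (b *ᴮ w) ∎

  roundtrip : ∀ i → lookup components i ≋ M *ᴮ lookup coordinates i
  roundtrip x# = B.trans (B.*-congˡ Q≋)
    (solve 3 (λ b x q → :ι 4ℚ :* (b :^ 2 :* (:ι 2ℚ :* x) :^ 2) :* q
          := :ι 16ℚ :* (b :^ 2 :* x) :* q :* x) B.refl b x Q′)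
  roundtrip y# = B.trans (B.*-cong P≋ Q≋)
    (solve 4 (λ b x y q → :ι 16ℚ :* (b :^ 2 :* (x :* y)) :* q
          := :ι 16ℚ :* (b :^ 2 :* x) :* q :* y) B.refl b x y Q′)
  roundtrip u# = B.trans (B.*-congˡ Q≋)
    (solve 4 (λ b x u q → :ι 4ℚ :* (b :^ 2 :* ((:ι 2ℚ :* x) :* (:ι 2ℚ :* u))) :* q
          := :ι 16ℚ :* (b :^ 2 :* x) :* q :* u) B.refl b x u Q′)
  roundtrip v# = B.trans (B.*-cong (B.*-congˡ 2b²+c²) Q≋)
    (solve 4 (λ b x v q → :ι 2ℚ :* (b :* (:ι 2ℚ :* x)) :* (:ι 4ℚ :* (b :* v)) :* q
          := :ι 16ℚ :* (b :^ 2 :* x) :* q :* v) B.refl b x v Q′)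
  roundtrip w# = B.trans (B.*-cong (B.*-congˡ 2b²-c²) Q≋)
    (solve 4 (λ b x w q → :ι 2ℚ :* (b :* (:ι 2ℚ :* x)) :* (:ι 4ℚ :* (b :* w)) :* q
          := :ι 16ℚ :* (b :^ 2 :* x) :* q :* w) B.refl b x w Q′)
  roundtrip z# = begin
    ι 16ℚ *ᴮ (b ^ᴮ 4 *ᴮ ((ι 2ℚ *ᴮ x) ^ᴮ 2 *ᴮ (ι 2ℚ *ᴮ u) ^ᴮ 2))
      ≈⟨ solve 3 (λ b x u → :ι 16ℚ :* (b :^ 4 :* ((:ι 2ℚ :* x) :^ 2 :* (:ι 2ℚ :* u) :^ 2))
                         := :ι 16ℚ :* (b :^ 2 :* x) :* (:ι 16ℚ :* (b :^ 2 :* x)) :* (u :* u)) B.refl b x u ⟩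
    ι 16ℚ *ᴮ (b ^ᴮ 2 *ᴮ x) *ᴮ (ι 16ℚ *ᴮ (b ^ᴮ 2 *ᴮ x)) *ᴮ (u *ᴮ u)
      ≈⟨ B.*-congˡ u² ⟩
    ι 16ℚ *ᴮ (b ^ᴮ 2 *ᴮ x) *ᴮ (ι 16ℚ *ᴮ (b ^ᴮ 2 *ᴮ x)) *ᴮ ((x +ᴮ y) *ᴮ z)
      ≈⟨ solve 3 (λ t s z → t :* t :* (s :* z)
            := t :* (t :* s) :* z) B.refl (ι 16ℚ *ᴮ (b ^ᴮ 2 *ᴮ x)) (x +ᴮ y) z ⟩
    M *ᴮ z ∎

  b-divides : (v -ᴮ w) *ᴮ b ≋ ι 2ℚ *ᴮ ((x +ᴮ y) *ᴮ z)
  b-divides = begin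
    (v -ᴮ w) *ᴮ b
      ≈⟨ solve 2 (λ v w → (v :- w) :* (v :+ w) := v :* v :- w :* w) B.refl v w ⟩
    v *ᴮ v -ᴮ w *ᴮ w         ≈⟨ 2u² ⟨
    ι 2ℚ *ᴮ (u *ᴮ u)         ≈⟨ B.*-congˡ u² ⟩
    ι 2ℚ *ᴮ ((x +ᴮ y) *ᴮ z)  ∎

-- Regularity of M

-- A polynomial is nonzero because its coefficient at m is.
nonzero-at : ∀ {n} (f : Poly n) m {_ : False (coeff f m ℚ.≟ 0ℚ)} → ¬ (f ≈ [])
nonzero-at f m {c≢0} f≈0 = toWitnessFalse c≢0 (coeff-≡ f≈0 m)

module S/I = ℚAlgebra S/I

module _ where
  open Freeness using (Regular-S/I)
  open Tower using (ν-var; module ν; module base; module K₃)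

  con-Regular : ∀ c → c ≢ 0ℚ → Regular S/I (con c)
  con-Regular c c≢0 = Regular-S/I {con c} {con c}
    (K₃.trans (ν.ι-homo c) (K₃.sym (base.ι-homo c)))
    (λ p → c≢0 (trans (sym (ℚ.+-identityʳ c)) (coeff-≡ p (0 ∷ 0 ∷ 0 ∷ []))))

  x-Regular : Regular S/I (var x#)
  x-Regular = Regular-S/I {var x#} {Tower.x} (ν-var x#) (nonzero-at (var 0F) (1 ∷ 0 ∷ 0 ∷ []))

  z-Regular : Regular S/I (var z#)
  z-Regular = Regular-S/I {var z#} {Tower.z} (ν-var z#) (nonzero-at (var 2F) (0 ∷ 0 ∷ 1 ∷ []))

  x+y-Regular : Regular S/I (var x# + var y#)
  x+y-Regular = Regular-S/I {var x# + var y#} {Tower.x + Tower.y}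
    (K₃.trans (ν.+-homo (var x#) (var y#))
      (K₃.trans (K₃.+-cong (ν-var x#) (ν-var y#)) (K₃.sym (base.+-homo Tower.x Tower.y))))
    (nonzero-at (var 0F + var 1F) (1 ∷ 0 ∷ 0 ∷ []))

open Roundtrip tautological using (b; M; Q′; roundtrip; b-divides)

-- A divisor of a regular element is regular.
b-Regular : Regular S/I b
b-Regular = Regular-factorʳ {S/I} (var v# - var w#) b
  (Regular-resp-≋ {S/I} {con 2ℚ * ((var x# + var y#) * var z#)} (S/I.sym {(var v# - var w#) * b} b-divides)
    (Regular-* {S/I} {con 2ℚ} {(var x# + var y#) * var z#} (con-Regular 2ℚ λ ())
      (Regular-* {S/I} {var x# + var y#} {var z#} x+y-Regular z-Regular)))

M-Regular : Regular S/I M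
M-Regular = Regular-* {S/I} {k} {Q′} k-Regular (Regular-* {S/I} {k} {var x# + var y#} k-Regular x+y-Regular)
  where
  k : Poly 6
  k = con 16ℚ * (b S/I.^ 2 * var x#)

  k-Regular : Regular S/I k
  k-Regular = Regular-* {S/I} {con 16ℚ} {b S/I.^ 2 * var x#} (con-Regular 16ℚ λ ())
    (Regular-* {S/I} {b S/I.^ 2} {var x#} (Regular-^ {S/I} {b} b-Regular 2) x-Regular)

-- The kernel of the parametrisation

module φ = Parametrisation (poly 3) (var 0F) (var 1F) (var 2F)

-- The six forms that represent the parametrisation.
φ-components : Vec (Poly 3) 6
φ-components = φ.components

φ-form : ∀ i → Form 8 (lookup φ-components i)
φ-form = λ
  { x# → form 8 _ ; y# → form 8 _ ; u# → form 8 _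
  ; v# → form 8 _ ; w# → form 8 _ ; z# → form 8 _ }
  where
  form : ∀ {n} d (f : Poly n) {_ : True (All.all? (λ t → Vec.sum (proj₂ t) ℕ.≟ d) f)} → Form d f
  form d f {p} = toWitness p

-- The three forms that represent the inverse map.
ψ-components : Vec (Poly 6) 3
ψ-components = var v# + var w# ∷ con 2ℚ * var x# ∷ con 2ℚ * var u# ∷ []

-- Substitution of φ.
θ : Homomorphism (poly 6) (poly 3)
θ = substitution φ-components
module θ = Homomorphism θ

θ-var : ∀ i → θ.⟦ var i ⟧ ≈ lookup φ-components i
θ-var = var-⟪⟫ φ-components

-- The components of φ satisfy the equations of X.
φ-point : Point (poly 3)
φ-point = record
  { coordinates = φ-components
  ; u² = by-computation _ _
  ; v² = by-computation _ _
  ; w² = by-computation _ _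
  }

ideal⇒kernel : ∀ {f} → f ∈⟨ eqs X ⟩ → f ⟪ φ-components ⟫ ≈ []
ideal⇒kernel = kills-ideal (eqs X) θ (quadrics-vanish φ-point θ θ-var)

-- Substitution of ψ, modulo the ideal of X.
σ : Homomorphism (poly 3) S/I
σ = projection ∘ʰ substitution ψ-components
module σ = Homomorphism σ

-- φ ∘ ψ is the identity up to the factor M.
σ-φ : ∀ i → σ.⟦ lookup φ-components i ⟧ ∼ M * lookup vars i
σ-φ i = S/I.trans
  (parametrisation-homo σ (var 0F) (var 1F) (var 2F)
    (I.≈⇒∼ (var-⟪⟫ ψ-components 0F)) (I.≈⇒∼ (var-⟪⟫ ψ-components 1F)) (I.≈⇒∼ (var-⟪⟫ ψ-components 2F)) i)
  (roundtrip i)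

-- Substitution of ψ into f ⟪ φ ⟫ is evaluation of f at M times the variables.
module Kernel where
  open Evaluation S/I using (ev; ev-var)

  -- The variables multiplied by M.
  scaled : Vec (Poly 6) 6
  scaled = Vec.map (M *_) vars

  lookup-scaled : ∀ i → lookup scaled i ≡ M * lookup vars i
  lookup-scaled i = Vec.lookup-map i (M *_) vars

  σθ : ∀ f → σ.⟦ f ⟪ φ-components ⟫ ⟧ ∼ ev scaled f
  σθ = hom-unique (σ ∘ʰ θ) (evʰ S/I scaled) λ i → S/I.trans (σ.⟦⟧-cong (θ-var i))
    (S/I.trans (σ-φ i) (S/I.sym (S/I.trans (ev-var scaled i) (S/I.reflexive (lookup-scaled i)))))

  ev-vars : ∀ f → ev vars f ∼ f
  ev-vars = hom-unique (evʰ S/I vars) projection λ i →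
    S/I.trans (ev-var vars i) (S/I.reflexive (Vec.lookup∘tabulate var i))

  -- For a form f of degree d the value at M times the variables is M^d f.
  form-kernel⇒ideal : ∀ {d f} → Form d f → f ⟪ φ-components ⟫ ≈ [] → f ∈⟨ eqs X ⟩
  form-kernel⇒ideal {d} {f} f-form θf≈0 = I.∼0⇒∈ (Regular-^ {S/I} {M} M-Regular d (begin
    M S/I.^ d * f               ≈⟨ S/I.*-congˡ {M S/I.^ d} (ev-vars f) ⟨
    M S/I.^ d * ev vars f
      ≈⟨ ev-scale S/I vars scaled M (λ i → S/I.reflexive (lookup-scaled i)) f-form ⟨
    ev scaled f                 ≈⟨ σθ f ⟨
    σ.⟦ f ⟪ φ-components ⟫ ⟧    ≈⟨ σ.⟦⟧-cong θf≈0 ⟩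
    σ.⟦ [] ⟧                    ≈⟨ σ.0-homo ⟩
    []                          ∎))
    where open ≈-Reasoning S/I.setoid

kernel⇒ideal : ∀ f → f ⟪ φ-components ⟫ ≈ [] → f ∈⟨ eqs X ⟩
kernel⇒ideal f θf≈0 = components-induction (_∈⟨ eqs X ⟩) I.∈-resp-≈ I.∈-0 I.∈-+ f λ k →
  Kernel.form-kernel⇒ideal (Form-component k f)
    (subst (_≈ []) (component-⟪⟫ φ-components φ-form k f)
      (restrict-cong (λ e → Vec.sum e ℕ.≟ 8 ℕ.* k) θf≈0))

-- Vanishing on X and on ℙ²

∈⇒VanishesOn : ∀ {n} (Y : ProjScheme n) {f} → f ∈⟨ eqs Y ⟩ → VanishesOn Y f
∈⇒VanishesOn Y {f} p i = 0 , Ideal.∈-resp-≈ (eqs Y) (+.reflexive (sym (Multiplication.*-identityˡ f))) p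

≈0⇒VanishesOn : ∀ {n} (Y : ProjScheme n) {f} → f ≈ [] → VanishesOn Y f
≈0⇒VanishesOn Y p = ∈⇒VanishesOn Y (Ideal.∈-resp-≈ (eqs Y) (+.sym p) (Ideal.∈-0 (eqs Y)))

-- The chart x ≠ 0 suffices, because θ x is not a zero divisor.
VanishesOn-X⇒kernel : ∀ {f} → VanishesOn X f → f ⟪ φ-components ⟫ ≈ []
VanishesOn-X⇒kernel {f} vf with N , p ← vf x# = *-cancel-≈0 (^-≉0 θx≉0 N) (begin
  lookup φ-components x# ^ N * f ⟪ φ-components ⟫
    ≈⟨ *-congʳ (f ⟪ φ-components ⟫) (poly-^-homo θ (var x#) (θ-var x#) N) ⟨
  θ.⟦ var x# ^ N ⟧ * f ⟪ φ-components ⟫           ≈⟨ θ.*-homo (var x# ^ N) f ⟨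
  (var x# ^ N * f) ⟪ φ-components ⟫               ≈⟨ ideal⇒kernel p ⟩
  []                                              ∎)
  where
  open Multiplication using (*-congʳ)
  open ≈-Reasoning +.setoid

  -- The coefficient of a⁶l² is 16.
  θx≉0 : ¬ (lookup φ-components x# ≈ [])
  θx≉0 = nonzero-at (lookup φ-components x#) (6 ∷ 2 ∷ 0 ∷ [])

VanishesOn-X⇒∈ : ∀ {f} → VanishesOn X f → f ∈⟨ eqs X ⟩
VanishesOn-X⇒∈ {f} p = kernel⇒ideal f (VanishesOn-X⇒kernel p)

VanishesOn-ℙ²⇒≈0 : ∀ {f} → VanishesOn (ℙ 2) f → f ≈ []
VanishesOn-ℙ²⇒≈0 {f} vf with N , [] , p ← vf 0F =
  *-cancel-≈0 (^-≉0 (nonzero-at (var 0F) (1 ∷ 0 ∷ 0 ∷ [])) N) p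

X-isIntegral : IsIntegral X
X-isIntegral = record
  { nonempty = λ v → nonzero-at (con {3} 1ℚ) (0 ∷ 0 ∷ 0 ∷ []) (+.trans (+.sym θ.1-homo) (VanishesOn-X⇒kernel v))
  ; prime    = λ f g v → Sum.map (∈⇒VanishesOn X ∘ kernel⇒ideal f) (∈⇒VanishesOn X ∘ kernel⇒ideal g)
      (*-≈0 (f ⟪ φ-components ⟫) (g ⟪ φ-components ⟫)
        (+.trans (+.sym (θ.*-homo f g)) (VanishesOn-X⇒kernel v)))
  }

-- The birational maps

φ-map : RationalMap (ℙ 2) X
φ-map = record
  { degree      = 8
  ; components  = φ-components
  ; homogeneous = λ i → terms⇒Homogeneous (lookup φ-components i) (φ-form i)
  -- The last component is 16 a⁴ l² c².
  ; nonzero     = 5F , λ v → nonzero-at (lookup φ-components z#) (4 ∷ 2 ∷ 2 ∷ []) (VanishesOn-ℙ²⇒≈0 v)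
  ; image       = λ i → ≈0⇒VanishesOn (ℙ 2) (ideal⇒kernel (I.∈-generator i))
  }

-- ψ ∘ φ multiplies the coordinates of ℙ² by this polynomial.
multiplier : Poly 3
multiplier = con 8ℚ * (var 0F ^ 2 * var 1F) * φ.Q

ψφ : ∀ i → lookup ψ-components i ⟪ φ-components ⟫ ≈ multiplier * lookup vars i
ψφ 0F = by-computation (lookup ψ-components 0F ⟪ φ-components ⟫) (multiplier * lookup vars 0F)
ψφ 1F = by-computation (lookup ψ-components 1F ⟪ φ-components ⟫) (multiplier * lookup vars 1F)
ψφ 2F = by-computation (lookup ψ-components 2F ⟪ φ-components ⟫) (multiplier * lookup vars 2F)

-- The coefficient of a⁷l is 32.
ψφ-nonzero : ¬ (lookup ψ-components 0F ⟪ φ-components ⟫ ≈ [])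
ψφ-nonzero p = nonzero-at (multiplier * var 0F) (7 ∷ 1 ∷ 0 ∷ []) (+.trans (+.sym (ψφ 0F)) p)

ψ-form : ∀ i → Form 1 (lookup ψ-components i)
ψ-form 0F = refl ∷ refl ∷ []
ψ-form 1F = refl ∷ []
ψ-form 2F = refl ∷ []

ψ-map : RationalMap X (ℙ 2)
ψ-map = record
  { degree      = 1
  ; components  = ψ-components
  ; homogeneous = λ i → terms⇒Homogeneous (lookup ψ-components i) (ψ-form i)
  ; nonzero     = 0F , λ v → ψφ-nonzero (VanishesOn-X⇒kernel {lookup ψ-components 0F} v)
  ; image       = λ ()
  }

-- A composite whose components are those of the identity, up to a common
-- factor.
module _ {n m} {Y : ProjScheme n} {Z : ProjScheme m} (β : RationalMap Z Y) (α : RationalMap Y Z) where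
  open RationalMap using (components)
  private
    module J = Ideal (eqs Y)
    module R = ℚAlgebra J.quotient
  open Solver J.quotient

  composeToId : ∀ i → ¬ VanishesOn Y (lookup (components β) i ⟪ components α ⟫) →
    ∀ μ → (∀ i → lookup (components β) i ⟪ components α ⟫ J.∼ μ * lookup vars i) →
    ComposeToId β α
  composeToId i v μ p =
    (i , λ v′ → v (subst (VanishesOn Y) (lookup-βα i) v′)) ,
    λ i j → ∈⇒VanishesOn Y (subst₂ (λ F G → (F * lookup vars j - G * lookup vars i) ∈⟨ eqs Y ⟩)
      (sym (lookup-βα i)) (sym (lookup-βα j)) (J.∼0⇒∈ (minor (p i) (p j))))
    where
    lookup-βα : ∀ i → lookup (Vec.map (_⟪ components α ⟫) (components β)) i ≡ lookup (components β) i ⟪ components α ⟫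
    lookup-βα i = Vec.lookup-map i _ (components β)

    minor : ∀ {F G x y} → F J.∼ μ * x → G J.∼ μ * y → F * y - G * x J.∼ []
    minor {F} {G} {x} {y} p q = R.trans
      (R.+-cong {F * y} {μ * x * y} {u = - (G * x)} (R.*-congʳ {y} p) (R.-‿cong {G * x} (R.*-congʳ {x} q)))
      (R.trans (solve 3 (λ μ x y → μ :* x :* y :- μ :* y :* x := :ι 0ℚ) R.refl μ x y) ι-0)

ψφ-id : ComposeToId ψ-map φ-map
ψφ-id = composeToId ψ-map φ-map 0F (λ v → ψφ-nonzero (VanishesOn-ℙ²⇒≈0 {lookup ψ-components 0F ⟪ φ-components ⟫} v))
  multiplier (λ i → Ideal.≈⇒∼ [] (ψφ i))

-- Modulo I the form in question is M z, a product of regular elements.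
φψ-nonzero : ¬ VanishesOn X (lookup φ-components z# ⟪ ψ-components ⟫)
φψ-nonzero v = IsIntegral.nonempty X-isIntegral (∈⇒VanishesOn X (I.∼0⇒∈
  (Regular-* {S/I} {M} {var z#} M-Regular z-Regular {con 1ℚ}
    (S/I.trans {M * var z# * con 1ℚ} {M * var z#} (S/I.*-identityʳ (M * var z#))
      (S/I.trans {M * var z#} {lookup φ-components z# ⟪ ψ-components ⟫} (S/I.sym {lookup φ-components z# ⟪ ψ-components ⟫} (σ-φ z#))
        (I.∈⇒∼0 (VanishesOn-X⇒∈ {lookup φ-components z# ⟪ ψ-components ⟫} v)))))))

φψ-id : ComposeToId φ-map ψ-map
φψ-id = composeToId φ-map ψ-map z# φψ-nonzero M σ-φ

φ-birational : IsBirational φ-map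
φ-birational = ψ-map , ψφ-id , φψ-id

φ-givenBy : φ-map GivenBy parametrisation
φ-givenBy = record
  -- The last component becomes 16 a⁴ l².
  { meetsChart = λ p → nonzero-at (Vec.last F) (4 ∷ 2 ∷ []) (+.trans p (term-0 (0 ∷ 0 ∷ [])))
  ; den≉0      = λ
    { 0F → den-nonzero 0F (2 ∷ 0 ∷ []) ; 1F → den-nonzero 1F (4 ∷ 2 ∷ []) ; 2F → den-nonzero 2F (2 ∷ 1 ∷ [])
    ; 3F → den-nonzero 3F (3 ∷ 1 ∷ []) ; 4F → den-nonzero 4F (3 ∷ 1 ∷ []) }
  ; agrees     = λ { 0F → agree 0F ; 1F → agree 1F ; 2F → agree 2F ; 3F → agree 3F ; 4F → agree 4F }
  }
  where
  open Fraction

  F : Vec (Poly 2) 6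
  F = Vec.map dehomogenise φ-components

  -- Each denominator is a nonzero multiple of the monomial m.
  den-nonzero : ∀ i m {_ : False (coeff (den (lookup parametrisation i)) m ℚ.≟ 0ℚ)} →
                ¬ (den (lookup parametrisation i) ≈ con 0ℚ)
  den-nonzero i m {c≢0} p = nonzero-at (den (lookup parametrisation i)) m {c≢0} (+.trans p (term-0 (0 ∷ 0 ∷ [])))

  agree : ∀ i → let f = lookup (Vec.init F) i * den (lookup parametrisation i)
                    g = num (lookup parametrisation i) * Vec.last F
          in {_ : True (coeffsAgree? f g)} → f ≈ g
  agree i {p} = by-computation _ _ {p}

mainTheorem2 : IsRationalSurface X × ∃ λ (φ : RationalMap (ℙ 2) X) → (φ GivenBy parametrisation) × IsBirational φ
mainTheorem2 = (X-isIntegral , φ-map , φ-birational) , φ-map , φ-givenBy , φ-birational
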